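{- For every integer $N\ge1$ and every integer $n\ge0$, the following identity holds (as rational functions in $x$): $$U_{n}^{(N+1)}(x)=\frac{1}{2^{N}N!}\sum_{i=1}^{N}a_{i}(N)\sum_{l=0}^{n}\binom{2N+n-l-i-1}{n-l}U_{l+i}(x)\,x^{i+l-2N-n}\,(l+i)_{i}.$$
   Context: The Chebyshev polynomials of the second kind $U_n(x)$ and the higher-order ones $U_n^{(\alpha)}(x)$ are defined by the formal power series in $t$ $$\frac{1}{1-2xt+t^{2}}=\sum_{n=0}^{\infty}U_{n}(x)t^{n},\qquad \left(\frac{1}{1-2xt+t^{2}}\right)^{\alpha}=\sum_{n=0}^{\infty}U_{n}^{(\alpha)}(x)t^{n}.$$ For a number $y$ and integer $n\ge1$, $(y)_{n}=y(y-1)\cdots(y-n+1)$ is the falling factorial, and $(y)_{0}=1$. The double factorial is $(2k-1)!!=(2k-1)(2k-3)\cdots 3\cdot 1$ for $k\ge1$, with $(-1)!!=1$. The numbers $a_i(N)$, $1\le i\le N$, are defined by $a_{1}(N)=(2N-3)!!$ and, for $2\le i\le N$, $$a_{i}(N)=\sum_{k_{i-1}=0}^{N-i}\ \sum_{k_{i-2}=0}^{N-i-k_{i-1}}\cdots\sum_{k_{1}=0}^{N-i-k_{i-1}-\cdots-k_{2}}2^{\sum_{j=1}^{i-1}k_{j}}\left[\prod_{j=2}^{i}\left(N-\sum_{l=j}^{i-1}k_{l}-\frac{2i+2-j}{2}\right)_{k_{j-1}}\right]\left(2\left(N-i-\sum_{j=1}^{i-1}k_{j}\right)-1\right)!!,$$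 where empty sums are $0$. -}

module Defs where

open import Level using (0ℓ; _⊔_)
open import Algebra.Bundles using (RawMonoid; RawSemiring; CommutativeRing)
import Algebra.Definitions.RawMonoid as RawMonoidDefs
import Algebra.Definitions.RawSemiring as RawSemiringDefs
import Algebra.Properties.Ring as RingProperties
import Algebra.Properties.Semiring.Exp as SemiringExp
import Algebra.Solver.Ring.NaturalCoefficients.Default as SemiringSolver
open import Data.Bool.Base using (if_then_else_)
open import Data.Fin.Base using (toℕ)
open import Data.Integer.Base as ℤ using (ℤ; +_; -[1+_])
open import Data.List.Base using (List; []; _∷_; map)
open import Data.Nat.Base as ℕ using (ℕ; zero; suc; _∸_; _≡ᵇ_; _!)
import Data.Nat.Properties as ℕₚ
open import Data.Product.Base using (_,_)
open import Data.Rational.Base as ℚ using (ℚ; 0ℚ; 1ℚ)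
import Data.Rational.Properties as ℚₚ
open import Data.Sum.Base as Sum using (_⊎_; inj₁; inj₂; [_,_]′)
open import Function.Base using (_∘_)
open import Relation.Binary.Bundles using (Setoid)
open import Relation.Binary.Core using (Rel)
open import Relation.Binary.Structures using (IsEquivalence)
open import Relation.Binary.PropositionalEquality
  using (_≡_; _≢_; refl; sym; trans; cong; cong₂; module ≡-Reasoning)
open import Relation.Nullary.Decidable.Core using (yes; no)
open import Relation.Nullary.Negation using (¬_; contradiction)
import Relation.Binary.Reasoning.Setoid as SetoidReasoning

-- Both bounds are included; the interval is empty when hi < lo.
module Interval {c ℓ} (M : RawMonoid c ℓ) where
  open RawMonoid M using (Carrier)

  fold : ℕ → ℕ → (ℕ → Carrier) → Carrier
  fold lo hi f = RawMonoidDefs.sum M {suc hi ∸ lo} (λ j → f (lo ℕ.+ toℕ j))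

module Summation {c ℓ} (M : RawMonoid c ℓ) where
  ∑ = Interval.fold M
  syntax ∑ lo hi (λ j → t) = ∑[ j ∈ lo ⋯ hi ] t
  infixl 5 ∑

module Multiplication {c ℓ} (M : RawMonoid c ℓ) where
  ∏ = Interval.fold M
  syntax ∏ lo hi (λ j → t) = ∏[ j ∈ lo ⋯ hi ] t
  infixl 5 ∏

module PowerSeries {c ℓ} (R : CommutativeRing c ℓ) where
  open CommutativeRing R
  open Summation +-rawMonoid

  Series : Set c
  Series = ℕ → Carrier

  infix 4 _≋_
  _≋_ : Rel Series ℓ
  f ≋ g = ∀ n → f n ≈ g n

  0ˢ 1ˢ : Series
  0ˢ _       = 0#
  1ˢ zero    = 1#
  1ˢ (suc _) = 0#

  infixl 6 _+ˢ_
  infixl 7 _*ˢ_ _÷ˢ_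

  _+ˢ_ _*ˢ_ : Series → Series → Series
  (f +ˢ g) n = f n + g n
  (f *ˢ g) n = ∑[ k ∈ 0 ⋯ n ] (f (n ∸ k) * g k)

  rawSemiring : RawSemiring c ℓ
  rawSemiring = record
    { _≈_ = _≋_ ; _+_ = _+ˢ_ ; _*_ = _*ˢ_ ; 0# = 0ˢ ; 1# = 1ˢ }

  infixr 8 _^ˢ_
  _^ˢ_ : Series → ℕ → Series
  _^ˢ_ = RawSemiringDefs._^_ rawSemiring

  -- Long division by a series with constant term 1: the quotient starts
  -- with g 0, and its tail is the quotient of (g - g 0 · f) / t by f.
  _÷ˢ_ : Series → Series → Series
  (g ÷ˢ f) zero    = g 0
  (g ÷ˢ f) (suc n) = ((λ k → g (suc k) - g 0 * f (suc k)) ÷ˢ f) n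

  private module ≈-R = SetoidReasoning setoid

  ÷ˢ-correct : ∀ f g → f 0 ≈ 1# → f *ˢ (g ÷ˢ f) ≋ g
  ÷ˢ-correct f g f₀≈1 zero = begin
    f 0 * g 0 + 0#  ≈⟨ +-identityʳ _ ⟩
    f 0 * g 0       ≈⟨ *-congʳ f₀≈1 ⟩
    1# * g 0        ≈⟨ *-identityˡ _ ⟩
    g 0             ∎
    where open ≈-R
  ÷ˢ-correct f g f₀≈1 (suc n) = begin
    b + (f *ˢ (g′ ÷ˢ f)) n               ≈⟨ +-congˡ (÷ˢ-correct f g′ f₀≈1 n) ⟩
    b + (g (suc n) - g 0 * f (suc n))    ≈⟨ +-comm _ _ ⟩
    g (suc n) - g 0 * f (suc n) + b      ≈⟨ +-assoc _ _ _ ⟩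
    g (suc n) + (- (g 0 * f (suc n)) + b) ≈⟨ +-congˡ (+-congˡ (*-comm _ _)) ⟩
    g (suc n) + (- (g 0 * f (suc n)) + g 0 * f (suc n))
                                         ≈⟨ +-congˡ (-‿inverseˡ _) ⟩
    g (suc n) + 0#                       ≈⟨ +-identityʳ _ ⟩
    g (suc n)                            ∎
    where
    open ≈-R
    b = f (suc n) * g 0
    g′ : Series
    g′ k = g (suc k) - g 0 * f (suc k)

NonTrivial : ∀ {c ℓ} → CommutativeRing c ℓ → Set ℓ
NonTrivial R = ¬ (1# ≈ 0#)
  where open CommutativeRing R

NoZeroDivisors : ∀ {c ℓ} → CommutativeRing c ℓ → Set (c ⊔ ℓ)
NoZeroDivisors R = ∀ x y → x * y ≈ 0# → x ≈ 0# ⊎ y ≈ 0#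
  where open CommutativeRing R

module Fractions {c ℓ} (R : CommutativeRing c ℓ)
  (1≉0 : NonTrivial R) (integral : NoZeroDivisors R)
  where

  open CommutativeRing R
    renaming (refl to ≈-refl; sym to ≈-sym; trans to ≈-trans)
  open RingProperties ring using (x∙y⁻¹≈ε⇒x≈y; x[y-z]≈xy-xz; -‿distribˡ-*)
  open SemiringSolver commutativeSemiring using (solve; _:=_; _:+_; _:*_)
  private module ≈-R = SetoidReasoning setoid

  *-nonzero : ∀ {x y} → ¬ (x ≈ 0#) → ¬ (y ≈ 0#) → ¬ (x * y ≈ 0#)
  *-nonzero x≉0 y≉0 xy≈0 = [ x≉0 , y≉0 ]′ (integral _ _ xy≈0)

  *-cancelˡ : ∀ s {x y} → ¬ (s ≈ 0#) → s * x ≈ s * y → x ≈ y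
  *-cancelˡ s {x} {y} s≉0 sx≈sy =
    [ (λ s≈0 → contradiction s≈0 s≉0) , x∙y⁻¹≈ε⇒x≈y x y ]′
      (integral s (x - y) (begin
        s * (x - y)      ≈⟨ x[y-z]≈xy-xz s x y ⟩
        s * x - s * y    ≈⟨ +-congʳ sx≈sy ⟩
        s * y - s * y    ≈⟨ -‿inverseʳ _ ⟩
        0#               ∎))
    where open ≈-R

  record Fraction : Set (c ⊔ ℓ) where
    constructor frac
    field
      num         : Carrier
      den         : Carrier
      den-nonzero : ¬ (den ≈ 0#)
  open Fraction public

  infix 4 _≈ᶠ_
  record _≈ᶠ_ (p q : Fraction) : Set ℓ where
    constructor cross
    field cross-eq : num p * den q ≈ num q * den p
  open _≈ᶠ_ public

  infixl 6 _+ᶠ_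
  infixl 7 _*ᶠ_
  infix  8 -ᶠ_

  _+ᶠ_ _*ᶠ_ : Fraction → Fraction → Fraction
  frac a b b≉0 +ᶠ frac c d d≉0 = frac (a * d + c * b) (b * d) (*-nonzero b≉0 d≉0)
  frac a b b≉0 *ᶠ frac c d d≉0 = frac (a * c) (b * d) (*-nonzero b≉0 d≉0)

  -ᶠ_ : Fraction → Fraction
  -ᶠ frac a b b≉0 = frac (- a) b b≉0

  embed : Carrier → Fraction
  embed a = frac a 1# 1≉0

  0ᶠ 1ᶠ : Fraction
  0ᶠ = embed 0#
  1ᶠ = embed 1#

  private
    ≈ᶠ-trans : ∀ {p q r} → p ≈ᶠ q → q ≈ᶠ r → p ≈ᶠ r
    ≈ᶠ-trans {frac a b _} {frac c d d≉0} {frac e f _} (cross ad≈cb) (cross cf≈ed) =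
      cross (*-cancelˡ d d≉0 (begin
        d * (a * f)  ≈⟨ solve 3 (λ d a f → d :* (a :* f) := (a :* d) :* f)
                          ≈-refl d a f ⟩
        (a * d) * f  ≈⟨ *-congʳ ad≈cb ⟩
        (c * b) * f  ≈⟨ solve 3 (λ c b f → (c :* b) :* f := (c :* f) :* b)
                          ≈-refl c b f ⟩
        (c * f) * b  ≈⟨ *-congʳ cf≈ed ⟩
        (e * d) * b  ≈⟨ solve 3 (λ e d b → (e :* d) :* b := d :* (e :* b))
                          ≈-refl e d b ⟩
        d * (e * b)  ∎))
      where open ≈-R

    ≈ᶠ-isEquivalence : IsEquivalence _≈ᶠ_
    ≈ᶠ-isEquivalence = record
      { refl  = cross ≈-refl
      ; sym   = λ (cross e) → cross (≈-sym e)
      ; trans = ≈ᶠ-trans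
      }

    +ᶠ-cong : ∀ {p p′ q q′} → p ≈ᶠ p′ → q ≈ᶠ q′ → p +ᶠ q ≈ᶠ p′ +ᶠ q′
    +ᶠ-cong {frac a b _} {frac a′ b′ _} {frac c d _} {frac c′ d′ _} (cross e₁) (cross e₂) =
      cross (begin
        (a * d + c * b) * (b′ * d′)
          ≈⟨ solve 6 (λ a b c d b′ d′ → (a :* d :+ c :* b) :* (b′ :* d′)
                        := (a :* b′) :* (d :* d′) :+ (c :* d′) :* (b :* b′))
               ≈-refl a b c d b′ d′ ⟩
        (a * b′) * (d * d′) + (c * d′) * (b * b′)
          ≈⟨ +-cong (*-congʳ e₁) (*-congʳ e₂) ⟩
        (a′ * b) * (d * d′) + (c′ * d) * (b * b′)
          ≈⟨ solve 6 (λ a′ b c′ d b′ d′ → (a′ :* b) :* (d :* d′) :+ (c′ :* d) :* (b :* b′)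
                        := (a′ :* d′ :+ c′ :* b′) :* (b :* d))
               ≈-refl a′ b c′ d b′ d′ ⟩
        (a′ * d′ + c′ * b′) * (b * d) ∎)
      where open ≈-R

    *ᶠ-cong : ∀ {p p′ q q′} → p ≈ᶠ p′ → q ≈ᶠ q′ → p *ᶠ q ≈ᶠ p′ *ᶠ q′
    *ᶠ-cong {frac a b _} {frac a′ b′ _} {frac c d _} {frac c′ d′ _} (cross e₁) (cross e₂) =
      cross (begin
        (a * c) * (b′ * d′)   ≈⟨ interchange a c b′ d′ ⟩
        (a * b′) * (c * d′)   ≈⟨ *-cong e₁ e₂ ⟩
        (a′ * b) * (c′ * d)   ≈⟨ interchange a′ b c′ d ⟩
        (a′ * c′) * (b * d)   ∎)
      where
      open ≈-R
      interchange = solve 4 (λ w x y z → (w :* x) :* (y :* z) := (w :* y) :* (x :* z))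
                      ≈-refl

    -ᶠ-cong : ∀ {p p′} → p ≈ᶠ p′ → -ᶠ p ≈ᶠ -ᶠ p′
    -ᶠ-cong {frac a b _} {frac a′ b′ _} (cross e) = cross (begin
        - a * b′    ≈⟨ -‿distribˡ-* a b′ ⟨
        - (a * b′)  ≈⟨ -‿cong e ⟩
        - (a′ * b)  ≈⟨ -‿distribˡ-* a′ b ⟩
        - a′ * b    ∎)
      where open ≈-R

    +ᶠ-assoc : ∀ p q r → (p +ᶠ q) +ᶠ r ≈ᶠ p +ᶠ (q +ᶠ r)
    +ᶠ-assoc (frac a b _) (frac c d _) (frac e f _) = cross
      (solve 6 (λ a b c d e f →
          ((a :* d :+ c :* b) :* f :+ e :* (b :* d)) :* (b :* (d :* f))
          := (a :* (d :* f) :+ (c :* f :+ e :* d) :* b) :* ((b :* d) :* f))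
        ≈-refl a b c d e f)

    +ᶠ-comm : ∀ p q → p +ᶠ q ≈ᶠ q +ᶠ p
    +ᶠ-comm (frac a b _) (frac c d _) = cross
      (solve 4 (λ a b c d → (a :* d :+ c :* b) :* (d :* b) := (c :* b :+ a :* d) :* (b :* d))
        ≈-refl a b c d)

    *ᶠ-assoc : ∀ p q r → (p *ᶠ q) *ᶠ r ≈ᶠ p *ᶠ (q *ᶠ r)
    *ᶠ-assoc (frac a b _) (frac c d _) (frac e f _) = cross
      (*-cong (*-assoc a c e) (≈-sym (*-assoc b d f)))

    *ᶠ-comm : ∀ p q → p *ᶠ q ≈ᶠ q *ᶠ p
    *ᶠ-comm (frac a b _) (frac c d _) = cross (*-cong (*-comm a c) (*-comm d b))

    *ᶠ-identityˡ : ∀ p → 1ᶠ *ᶠ p ≈ᶠ p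
    *ᶠ-identityˡ (frac a b _) = cross
      (*-cong (*-identityˡ a) (≈-sym (*-identityˡ b)))

    *ᶠ-identityʳ : ∀ p → p *ᶠ 1ᶠ ≈ᶠ p
    *ᶠ-identityʳ p = ≈ᶠ-trans (*ᶠ-comm p 1ᶠ) (*ᶠ-identityˡ p)

    +ᶠ-identityˡ : ∀ p → 0ᶠ +ᶠ p ≈ᶠ p
    +ᶠ-identityˡ (frac a b _) = cross (*-cong
      (≈-trans (+-cong (zeroˡ b) (*-identityʳ a)) (+-identityˡ a))
      (≈-sym (*-identityˡ b)))

    +ᶠ-identityʳ : ∀ p → p +ᶠ 0ᶠ ≈ᶠ p
    +ᶠ-identityʳ p = ≈ᶠ-trans (+ᶠ-comm p 0ᶠ) (+ᶠ-identityˡ p)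

    -ᶠ-inverseˡ : ∀ p → -ᶠ p +ᶠ p ≈ᶠ 0ᶠ
    -ᶠ-inverseˡ (frac a b _) = cross (begin
      (- a * b + a * b) * 1#  ≈⟨ *-identityʳ _ ⟩
      - a * b + a * b         ≈⟨ distribʳ b (- a) a ⟨
      (- a + a) * b           ≈⟨ *-congʳ (-‿inverseˡ a) ⟩
      0# * b                  ≈⟨ zeroˡ b ⟩
      0#                      ≈⟨ zeroˡ (b * b) ⟨
      0# * (b * b)            ∎)
      where open ≈-R

    -ᶠ-inverseʳ : ∀ p → p +ᶠ (-ᶠ p) ≈ᶠ 0ᶠ
    -ᶠ-inverseʳ p = ≈ᶠ-trans (+ᶠ-comm p (-ᶠ p)) (-ᶠ-inverseˡ p)

    *ᶠ-distribˡ-+ᶠ : ∀ p q r → p *ᶠ (q +ᶠ r) ≈ᶠ p *ᶠ q +ᶠ p *ᶠ r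
    *ᶠ-distribˡ-+ᶠ (frac a b _) (frac c d _) (frac e f _) = cross
      (solve 6 (λ a b c d e f →
          (a :* (c :* f :+ e :* d)) :* ((b :* d) :* (b :* f))
          := ((a :* c) :* (b :* f) :+ (a :* e) :* (b :* d)) :* (b :* (d :* f)))
        ≈-refl a b c d e f)

    *ᶠ-distribʳ-+ᶠ : ∀ p q r → (q +ᶠ r) *ᶠ p ≈ᶠ q *ᶠ p +ᶠ r *ᶠ p
    *ᶠ-distribʳ-+ᶠ p q r = ≈ᶠ-trans (*ᶠ-comm (q +ᶠ r) p)
      (≈ᶠ-trans (*ᶠ-distribˡ-+ᶠ p q r) (+ᶠ-cong (*ᶠ-comm p q) (*ᶠ-comm p r)))

  commutativeRing : CommutativeRing (c ⊔ ℓ) ℓ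
  commutativeRing = record
    { Carrier = Fraction
    ; _≈_ = _≈ᶠ_ ; _+_ = _+ᶠ_ ; _*_ = _*ᶠ_ ; -_ = -ᶠ_ ; 0# = 0ᶠ ; 1# = 1ᶠ
    ; isCommutativeRing = record
      { isRing = record
        { +-isAbelianGroup = record
          { isGroup = record
            { isMonoid = record
              { isSemigroup = record
                { isMagma = record
                  { isEquivalence = ≈ᶠ-isEquivalence ; ∙-cong = +ᶠ-cong }
                ; assoc = +ᶠ-assoc
                }
              ; identity = +ᶠ-identityˡ , +ᶠ-identityʳ
              }
            ; inverse = -ᶠ-inverseˡ , -ᶠ-inverseʳ
            ; ⁻¹-cong = -ᶠ-cong
            }
          ; comm = +ᶠ-comm
          }
        ; *-cong = *ᶠ-cong
        ; *-assoc = *ᶠ-assoc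
        ; *-identity = *ᶠ-identityˡ , *ᶠ-identityʳ
        ; distrib = *ᶠ-distribˡ-+ᶠ , *ᶠ-distribʳ-+ᶠ
        }
      ; *-comm = *ᶠ-comm
      }
    }

module Polynomial where
  open import Data.Rational.Base using (_+_; _*_; -_)

  -- Coefficients, constant term first.
  ℚ[x] : Set
  ℚ[x] = List ℚ

  coeff : ℚ[x] → ℕ → ℚ
  coeff []      _       = 0ℚ
  coeff (a ∷ p) zero    = a
  coeff (a ∷ p) (suc n) = coeff p n

  -- Trailing zero coefficients are not significant.
  infix 4 _≈ᵖ_
  record _≈ᵖ_ (p q : ℚ[x]) : Set where
    constructor coeffwise
    field coeff-eq : ∀ n → coeff p n ≡ coeff q n
  open _≈ᵖ_ public

  infixl 6 _+ᵖ_
  infixl 7 _*ᵖ_ _·ᵖ_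
  infix  8 -ᵖ_

  _+ᵖ_ : ℚ[x] → ℚ[x] → ℚ[x]
  []      +ᵖ q       = q
  (a ∷ p) +ᵖ []      = a ∷ p
  (a ∷ p) +ᵖ (b ∷ q) = a + b ∷ p +ᵖ q

  -ᵖ_ : ℚ[x] → ℚ[x]
  -ᵖ_ = map -_

  _·ᵖ_ : ℚ → ℚ[x] → ℚ[x]
  a ·ᵖ p = map (a *_) p

  _*ᵖ_ : ℚ[x] → ℚ[x] → ℚ[x]
  []      *ᵖ q = []
  (a ∷ p) *ᵖ q = a ·ᵖ q +ᵖ (0ℚ ∷ p *ᵖ q)

  constant : ℚ → ℚ[x]
  constant a = a ∷ []

  0ᵖ 1ᵖ X : ℚ[x]
  0ᵖ = []
  1ᵖ = constant 1ℚ
  X  = 0ℚ ∷ 1ℚ ∷ []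

  coeff-+ᵖ : ∀ p q n → coeff (p +ᵖ q) n ≡ coeff p n + coeff q n
  coeff-+ᵖ []      q       n       = sym (ℚₚ.+-identityˡ _)
  coeff-+ᵖ (a ∷ p) []      n       = sym (ℚₚ.+-identityʳ _)
  coeff-+ᵖ (a ∷ p) (b ∷ q) zero    = refl
  coeff-+ᵖ (a ∷ p) (b ∷ q) (suc n) = coeff-+ᵖ p q n

  coeff--ᵖ : ∀ p n → coeff (-ᵖ p) n ≡ - coeff p n
  coeff--ᵖ []      n       = refl
  coeff--ᵖ (a ∷ p) zero    = refl
  coeff--ᵖ (a ∷ p) (suc n) = coeff--ᵖ p n

  coeff-·ᵖ : ∀ a p n → coeff (a ·ᵖ p) n ≡ a * coeff p n
  coeff-·ᵖ a []      n       = sym (ℚₚ.*-zeroʳ a)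
  coeff-·ᵖ a (b ∷ p) zero    = refl
  coeff-·ᵖ a (b ∷ p) (suc n) = coeff-·ᵖ a p n

  ≈ᵖ-isEquivalence : IsEquivalence _≈ᵖ_
  ≈ᵖ-isEquivalence = record
    { refl  = coeffwise (λ _ → refl)
    ; sym   = λ (coeffwise e) → coeffwise (λ n → sym (e n))
    ; trans = λ (coeffwise e) (coeffwise f) → coeffwise (λ n → trans (e n) (f n))
    }

  private
    open IsEquivalence ≈ᵖ-isEquivalence
      renaming (refl to ≈-refl; sym to ≈-sym; trans to ≈-trans) using ()
    ≈ᵖ-setoid : Setoid 0ℓ 0ℓ
    ≈ᵖ-setoid = record { isEquivalence = ≈ᵖ-isEquivalence }
    module ≈-R = SetoidReasoning ≈ᵖ-setoid

    ∷-cong : ∀ {a b p q} → a ≡ b → p ≈ᵖ q → a ∷ p ≈ᵖ b ∷ q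
    ∷-cong a≡b (coeffwise e) = coeffwise λ { zero → a≡b ; (suc n) → e n }

    0∷0≈0 : 0ℚ ∷ [] ≈ᵖ []
    0∷0≈0 = coeffwise λ { zero → refl ; (suc n) → refl }

    +ᵖ-cong : ∀ {p p′ q q′} → p ≈ᵖ p′ → q ≈ᵖ q′ → p +ᵖ q ≈ᵖ p′ +ᵖ q′
    +ᵖ-cong {p} {p′} {q} {q′} (coeffwise e) (coeffwise f) = coeffwise λ n →
      trans (coeff-+ᵖ p q n) (trans (cong₂ _+_ (e n) (f n)) (sym (coeff-+ᵖ p′ q′ n)))

    +ᵖ-comm : ∀ p q → p +ᵖ q ≈ᵖ q +ᵖ p
    +ᵖ-comm p q = coeffwise λ n →
      trans (coeff-+ᵖ p q n) (trans (ℚₚ.+-comm (coeff p n) _) (sym (coeff-+ᵖ q p n)))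

    +ᵖ-assoc : ∀ p q r → (p +ᵖ q) +ᵖ r ≈ᵖ p +ᵖ (q +ᵖ r)
    +ᵖ-assoc p q r = coeffwise λ n → begin
      coeff ((p +ᵖ q) +ᵖ r) n               ≡⟨ coeff-+ᵖ (p +ᵖ q) r n ⟩
      coeff (p +ᵖ q) n + coeff r n          ≡⟨ cong (_+ coeff r n) (coeff-+ᵖ p q n) ⟩
      coeff p n + coeff q n + coeff r n     ≡⟨ ℚₚ.+-assoc (coeff p n) _ _ ⟩
      coeff p n + (coeff q n + coeff r n)   ≡⟨ cong (λ z → coeff p n + z) (coeff-+ᵖ q r n) ⟨
      coeff p n + coeff (q +ᵖ r) n          ≡⟨ coeff-+ᵖ p (q +ᵖ r) n ⟨
      coeff (p +ᵖ (q +ᵖ r)) n               ∎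
      where open ≡-Reasoning

    +ᵖ-identityʳ : ∀ p → p +ᵖ 0ᵖ ≈ᵖ p
    +ᵖ-identityʳ p = +ᵖ-comm p []

    -ᵖ-cong : ∀ {p q} → p ≈ᵖ q → -ᵖ p ≈ᵖ -ᵖ q
    -ᵖ-cong {p} {q} (coeffwise e) = coeffwise λ n →
      trans (coeff--ᵖ p n) (trans (cong -_ (e n)) (sym (coeff--ᵖ q n)))

    -ᵖ-inverseˡ : ∀ p → -ᵖ p +ᵖ p ≈ᵖ 0ᵖ
    -ᵖ-inverseˡ p = coeffwise λ n → trans (coeff-+ᵖ (-ᵖ p) p n)
      (trans (cong (_+ coeff p n) (coeff--ᵖ p n)) (ℚₚ.+-inverseˡ (coeff p n)))

    -ᵖ-inverseʳ : ∀ p → p +ᵖ (-ᵖ p) ≈ᵖ 0ᵖ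
    -ᵖ-inverseʳ p = ≈-trans (+ᵖ-comm p (-ᵖ p)) (-ᵖ-inverseˡ p)

    interchange : ∀ p q r s → (p +ᵖ q) +ᵖ (r +ᵖ s) ≈ᵖ (p +ᵖ r) +ᵖ (q +ᵖ s)
    interchange p q r s = begin
      (p +ᵖ q) +ᵖ (r +ᵖ s)  ≈⟨ +ᵖ-assoc p q (r +ᵖ s) ⟩
      p +ᵖ (q +ᵖ (r +ᵖ s))  ≈⟨ +ᵖ-cong (≈-refl {p}) (+ᵖ-assoc q r s) ⟨
      p +ᵖ ((q +ᵖ r) +ᵖ s)  ≈⟨ +ᵖ-cong (≈-refl {p}) (+ᵖ-cong (+ᵖ-comm q r) (≈-refl {s})) ⟩
      p +ᵖ ((r +ᵖ q) +ᵖ s)  ≈⟨ +ᵖ-cong (≈-refl {p}) (+ᵖ-assoc r q s) ⟩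
      p +ᵖ (r +ᵖ (q +ᵖ s))  ≈⟨ +ᵖ-assoc p r (q +ᵖ s) ⟨
      (p +ᵖ r) +ᵖ (q +ᵖ s)  ∎
      where open ≈-R

    ·ᵖ-cong : ∀ a {p q} → p ≈ᵖ q → a ·ᵖ p ≈ᵖ a ·ᵖ q
    ·ᵖ-cong a {p} {q} (coeffwise e) = coeffwise λ n →
      trans (coeff-·ᵖ a p n) (trans (cong (a *_) (e n)) (sym (coeff-·ᵖ a q n)))

    ·ᵖ-distribˡ : ∀ a p q → a ·ᵖ (p +ᵖ q) ≈ᵖ a ·ᵖ p +ᵖ a ·ᵖ q
    ·ᵖ-distribˡ a p q = coeffwise λ n → begin
      coeff (a ·ᵖ (p +ᵖ q)) n              ≡⟨ coeff-·ᵖ a (p +ᵖ q) n ⟩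
      a * coeff (p +ᵖ q) n                 ≡⟨ cong (a *_) (coeff-+ᵖ p q n) ⟩
      a * (coeff p n + coeff q n)          ≡⟨ ℚₚ.*-distribˡ-+ a (coeff p n) _ ⟩
      a * coeff p n + a * coeff q n        ≡⟨ cong₂ _+_ (coeff-·ᵖ a p n) (coeff-·ᵖ a q n) ⟨
      coeff (a ·ᵖ p) n + coeff (a ·ᵖ q) n  ≡⟨ coeff-+ᵖ (a ·ᵖ p) (a ·ᵖ q) n ⟨
      coeff (a ·ᵖ p +ᵖ a ·ᵖ q) n           ∎
      where open ≡-Reasoning

    ·ᵖ-distribʳ : ∀ a b p → (a + b) ·ᵖ p ≈ᵖ a ·ᵖ p +ᵖ b ·ᵖ p
    ·ᵖ-distribʳ a b p = coeffwise λ n → begin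
      coeff ((a + b) ·ᵖ p) n               ≡⟨ coeff-·ᵖ (a + b) p n ⟩
      (a + b) * coeff p n                  ≡⟨ ℚₚ.*-distribʳ-+ (coeff p n) a b ⟩
      a * coeff p n + b * coeff p n        ≡⟨ cong₂ _+_ (coeff-·ᵖ a p n) (coeff-·ᵖ b p n) ⟨
      coeff (a ·ᵖ p) n + coeff (b ·ᵖ p) n  ≡⟨ coeff-+ᵖ (a ·ᵖ p) (b ·ᵖ p) n ⟨
      coeff (a ·ᵖ p +ᵖ b ·ᵖ p) n           ∎
      where open ≡-Reasoning

    ·ᵖ-assoc : ∀ a b p → (a * b) ·ᵖ p ≈ᵖ a ·ᵖ (b ·ᵖ p)
    ·ᵖ-assoc a b p = coeffwise λ n → begin
      coeff ((a * b) ·ᵖ p) n     ≡⟨ coeff-·ᵖ (a * b) p n ⟩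
      a * b * coeff p n          ≡⟨ ℚₚ.*-assoc a b _ ⟩
      a * (b * coeff p n)        ≡⟨ cong (a *_) (coeff-·ᵖ b p n) ⟨
      a * coeff (b ·ᵖ p) n       ≡⟨ coeff-·ᵖ a (b ·ᵖ p) n ⟨
      coeff (a ·ᵖ (b ·ᵖ p)) n    ∎
      where open ≡-Reasoning

    ·ᵖ-zero : ∀ p → 0ℚ ·ᵖ p ≈ᵖ 0ᵖ
    ·ᵖ-zero p = coeffwise λ n → trans (coeff-·ᵖ 0ℚ p n) (ℚₚ.*-zeroˡ (coeff p n))

    ·ᵖ-one : ∀ p → 1ℚ ·ᵖ p ≈ᵖ p
    ·ᵖ-one p = coeffwise λ n → trans (coeff-·ᵖ 1ℚ p n) (ℚₚ.*-identityˡ (coeff p n))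

    *ᵖ-congˡ : ∀ p {q q′} → q ≈ᵖ q′ → p *ᵖ q ≈ᵖ p *ᵖ q′
    *ᵖ-congˡ []      e = ≈-refl
    *ᵖ-congˡ (a ∷ p) e = +ᵖ-cong (·ᵖ-cong a e) (∷-cong refl (*ᵖ-congˡ p e))

    *ᵖ-zeroʳ : ∀ p → p *ᵖ 0ᵖ ≈ᵖ 0ᵖ
    *ᵖ-zeroʳ []      = ≈-refl
    *ᵖ-zeroʳ (a ∷ p) = ≈-trans (∷-cong refl (*ᵖ-zeroʳ p)) 0∷0≈0

    *ᵖ-∷ : ∀ p b q → p *ᵖ (b ∷ q) ≈ᵖ b ·ᵖ p +ᵖ (0ℚ ∷ p *ᵖ q)
    *ᵖ-∷ []      b q = ≈-sym 0∷0≈0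
    *ᵖ-∷ (a ∷ p) b q = ∷-cong (cong (_+ 0ℚ) (ℚₚ.*-comm a b)) (begin
      a ·ᵖ q +ᵖ p *ᵖ (b ∷ q)                  ≈⟨ +ᵖ-cong (≈-refl {a ·ᵖ q}) (*ᵖ-∷ p b q) ⟩
      a ·ᵖ q +ᵖ (b ·ᵖ p +ᵖ (0ℚ ∷ p *ᵖ q))     ≈⟨ +ᵖ-assoc (a ·ᵖ q) _ _ ⟨
      (a ·ᵖ q +ᵖ b ·ᵖ p) +ᵖ (0ℚ ∷ p *ᵖ q)     ≈⟨ +ᵖ-cong (+ᵖ-comm (a ·ᵖ q) _) ≈-refl ⟩
      (b ·ᵖ p +ᵖ a ·ᵖ q) +ᵖ (0ℚ ∷ p *ᵖ q)     ≈⟨ +ᵖ-assoc (b ·ᵖ p) _ _ ⟩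
      b ·ᵖ p +ᵖ (a ·ᵖ q +ᵖ (0ℚ ∷ p *ᵖ q))     ∎)
      where open ≈-R

    *ᵖ-comm : ∀ p q → p *ᵖ q ≈ᵖ q *ᵖ p
    *ᵖ-comm []      q = ≈-sym (*ᵖ-zeroʳ q)
    *ᵖ-comm (a ∷ p) q = begin
      a ·ᵖ q +ᵖ (0ℚ ∷ p *ᵖ q)  ≈⟨ +ᵖ-cong (≈-refl {a ·ᵖ q}) (∷-cong refl (*ᵖ-comm p q)) ⟩
      a ·ᵖ q +ᵖ (0ℚ ∷ q *ᵖ p)  ≈⟨ *ᵖ-∷ q a p ⟨
      q *ᵖ (a ∷ p)             ∎
      where open ≈-R

    *ᵖ-cong : ∀ {p p′ q q′} → p ≈ᵖ p′ → q ≈ᵖ q′ → p *ᵖ q ≈ᵖ p′ *ᵖ q′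
    *ᵖ-cong {p} {p′} {q} {q′} e f = begin
      p *ᵖ q    ≈⟨ *ᵖ-congˡ p f ⟩
      p *ᵖ q′   ≈⟨ *ᵖ-comm p q′ ⟩
      q′ *ᵖ p   ≈⟨ *ᵖ-congˡ q′ e ⟩
      q′ *ᵖ p′  ≈⟨ *ᵖ-comm q′ p′ ⟩
      p′ *ᵖ q′  ∎
      where open ≈-R

    *ᵖ-distribˡ-+ᵖ : ∀ p q r → p *ᵖ (q +ᵖ r) ≈ᵖ p *ᵖ q +ᵖ p *ᵖ r
    *ᵖ-distribˡ-+ᵖ []      q r = ≈-refl
    *ᵖ-distribˡ-+ᵖ (a ∷ p) q r = begin
      a ·ᵖ (q +ᵖ r) +ᵖ (0ℚ ∷ p *ᵖ (q +ᵖ r))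
        ≈⟨ +ᵖ-cong (·ᵖ-distribˡ a q r) (∷-cong refl (*ᵖ-distribˡ-+ᵖ p q r)) ⟩
      (a ·ᵖ q +ᵖ a ·ᵖ r) +ᵖ ((0ℚ ∷ p *ᵖ q) +ᵖ (0ℚ ∷ p *ᵖ r))
        ≈⟨ interchange (a ·ᵖ q) (a ·ᵖ r) (0ℚ ∷ p *ᵖ q) (0ℚ ∷ p *ᵖ r) ⟩
      (a ·ᵖ q +ᵖ (0ℚ ∷ p *ᵖ q)) +ᵖ (a ·ᵖ r +ᵖ (0ℚ ∷ p *ᵖ r)) ∎
      where open ≈-R

    *ᵖ-distribʳ-+ᵖ : ∀ p q r → (q +ᵖ r) *ᵖ p ≈ᵖ q *ᵖ p +ᵖ r *ᵖ p
    *ᵖ-distribʳ-+ᵖ p q r = ≈-trans (*ᵖ-comm (q +ᵖ r) p)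
      (≈-trans (*ᵖ-distribˡ-+ᵖ p q r) (+ᵖ-cong (*ᵖ-comm p q) (*ᵖ-comm p r)))

    ·ᵖ-*ᵖ : ∀ a p q → (a ·ᵖ p) *ᵖ q ≈ᵖ a ·ᵖ (p *ᵖ q)
    ·ᵖ-*ᵖ a []      q = ≈-refl
    ·ᵖ-*ᵖ a (b ∷ p) q = begin
      (a * b) ·ᵖ q +ᵖ (0ℚ ∷ (a ·ᵖ p) *ᵖ q)
        ≈⟨ +ᵖ-cong (·ᵖ-assoc a b q) (∷-cong (sym (ℚₚ.*-zeroʳ a)) (·ᵖ-*ᵖ a p q)) ⟩
      a ·ᵖ (b ·ᵖ q) +ᵖ a ·ᵖ (0ℚ ∷ p *ᵖ q)
        ≈⟨ ·ᵖ-distribˡ a (b ·ᵖ q) (0ℚ ∷ p *ᵖ q) ⟨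
      a ·ᵖ (b ·ᵖ q +ᵖ (0ℚ ∷ p *ᵖ q)) ∎
      where open ≈-R

    0∷-*ᵖ : ∀ p q → (0ℚ ∷ p) *ᵖ q ≈ᵖ 0ℚ ∷ p *ᵖ q
    0∷-*ᵖ p q = +ᵖ-cong (·ᵖ-zero q) (≈-refl {0ℚ ∷ p *ᵖ q})

    *ᵖ-0∷ : ∀ p q → p *ᵖ (0ℚ ∷ q) ≈ᵖ 0ℚ ∷ p *ᵖ q
    *ᵖ-0∷ p q = ≈-trans (*ᵖ-∷ p 0ℚ q) (+ᵖ-cong (·ᵖ-zero p) (≈-refl {0ℚ ∷ p *ᵖ q}))

    *ᵖ-assoc : ∀ p q r → (p *ᵖ q) *ᵖ r ≈ᵖ p *ᵖ (q *ᵖ r)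
    *ᵖ-assoc []      q r = ≈-refl
    *ᵖ-assoc (a ∷ p) q r = begin
      (a ·ᵖ q +ᵖ (0ℚ ∷ p *ᵖ q)) *ᵖ r
        ≈⟨ *ᵖ-distribʳ-+ᵖ r (a ·ᵖ q) (0ℚ ∷ p *ᵖ q) ⟩
      (a ·ᵖ q) *ᵖ r +ᵖ (0ℚ ∷ p *ᵖ q) *ᵖ r
        ≈⟨ +ᵖ-cong (·ᵖ-*ᵖ a q r) (0∷-*ᵖ (p *ᵖ q) r) ⟩
      a ·ᵖ (q *ᵖ r) +ᵖ (0ℚ ∷ (p *ᵖ q) *ᵖ r)
        ≈⟨ +ᵖ-cong (≈-refl {a ·ᵖ (q *ᵖ r)}) (∷-cong refl (*ᵖ-assoc p q r)) ⟩
      a ·ᵖ (q *ᵖ r) +ᵖ (0ℚ ∷ p *ᵖ (q *ᵖ r)) ∎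
      where open ≈-R

    *ᵖ-identityˡ : ∀ p → 1ᵖ *ᵖ p ≈ᵖ p
    *ᵖ-identityˡ p = begin
      1ℚ ·ᵖ p +ᵖ (0ℚ ∷ [])  ≈⟨ +ᵖ-cong (·ᵖ-one p) 0∷0≈0 ⟩
      p +ᵖ []               ≈⟨ +ᵖ-identityʳ p ⟩
      p                     ∎
      where open ≈-R

    *ᵖ-identityʳ : ∀ p → p *ᵖ 1ᵖ ≈ᵖ p
    *ᵖ-identityʳ p = ≈-trans (*ᵖ-comm p 1ᵖ) (*ᵖ-identityˡ p)

  ℚ[x]-commutativeRing : CommutativeRing 0ℓ 0ℓ
  ℚ[x]-commutativeRing = record
    { Carrier = ℚ[x]
    ; _≈_ = _≈ᵖ_ ; _+_ = _+ᵖ_ ; _*_ = _*ᵖ_ ; -_ = -ᵖ_ ; 0# = 0ᵖ ; 1# = 1ᵖ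
    ; isCommutativeRing = record
      { isRing = record
        { +-isAbelianGroup = record
          { isGroup = record
            { isMonoid = record
              { isSemigroup = record
                { isMagma = record
                  { isEquivalence = ≈ᵖ-isEquivalence ; ∙-cong = +ᵖ-cong }
                ; assoc = +ᵖ-assoc
                }
              ; identity = (λ _ → ≈-refl) , +ᵖ-identityʳ
              }
            ; inverse = -ᵖ-inverseˡ , -ᵖ-inverseʳ
            ; ⁻¹-cong = -ᵖ-cong
            }
          ; comm = +ᵖ-comm
          }
        ; *-cong = *ᵖ-cong
        ; *-assoc = *ᵖ-assoc
        ; *-identity = *ᵖ-identityˡ , *ᵖ-identityʳ
        ; distrib = *ᵖ-distribˡ-+ᵖ , *ᵖ-distribʳ-+ᵖ
        }
      ; *-comm = *ᵖ-comm
      }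
    }

  1ᵖ≉0ᵖ : ¬ (1ᵖ ≈ᵖ 0ᵖ)
  1ᵖ≉0ᵖ (coeffwise e) with e 0
  ... | ()

  X≉0ᵖ : ¬ (X ≈ᵖ 0ᵖ)
  X≉0ᵖ (coeffwise e) with e 1
  ... | ()

  private
    ℚ-integral : ∀ a b → a ≢ 0ℚ → a * b ≡ 0ℚ → b ≡ 0ℚ
    ℚ-integral a b a≢0 ab≡0 = begin
      b                    ≡⟨ ℚₚ.*-identityˡ b ⟨
      1ℚ * b               ≡⟨ cong (_* b) (ℚₚ.*-inverseˡ a) ⟨
      ℚ.1/ a * a * b       ≡⟨ ℚₚ.*-assoc (ℚ.1/ a) a b ⟩
      ℚ.1/ a * (a * b)     ≡⟨ cong (ℚ.1/ a *_) ab≡0 ⟩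
      ℚ.1/ a * 0ℚ          ≡⟨ ℚₚ.*-zeroʳ (ℚ.1/ a) ⟩
      0ℚ                   ∎
      where
      open ≡-Reasoning
      instance _ = ℚ.≢-nonZero a≢0

    ∷-zero : ∀ {p} → p ≈ᵖ 0ᵖ → 0ℚ ∷ p ≈ᵖ 0ᵖ
    ∷-zero e = ≈-trans (∷-cong refl e) 0∷0≈0

    tail-zero : ∀ {a p} → a ∷ p ≈ᵖ 0ᵖ → p ≈ᵖ 0ᵖ
    tail-zero (coeffwise e) = coeffwise (e ∘ suc)

    integral-step : ∀ a p b q →
      (p *ᵖ (b ∷ q) ≈ᵖ 0ᵖ → p ≈ᵖ 0ᵖ ⊎ b ∷ q ≈ᵖ 0ᵖ) →
      ((a ∷ p) *ᵖ q ≈ᵖ 0ᵖ → a ∷ p ≈ᵖ 0ᵖ ⊎ q ≈ᵖ 0ᵖ) →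
      (a ∷ p) *ᵖ (b ∷ q) ≈ᵖ 0ᵖ → a ∷ p ≈ᵖ 0ᵖ ⊎ b ∷ q ≈ᵖ 0ᵖ
    integral-step a p b q ih₁ ih₂ e with a ℚₚ.≟ 0ℚ | b ℚₚ.≟ 0ℚ
    ... | yes refl | _ = Sum.map₁ ∷-zero
      (ih₁ (tail-zero (≈-trans (≈-sym (0∷-*ᵖ p (b ∷ q))) e)))
    ... | no _ | yes refl = Sum.map₂ ∷-zero
      (ih₂ (tail-zero (≈-trans (≈-sym (*ᵖ-0∷ (a ∷ p) q)) e)))
    ... | no a≢0 | no b≢0 = contradiction
      (ℚ-integral a b a≢0 (trans (sym (ℚₚ.+-identityʳ (a * b))) (coeff-eq e 0))) b≢0

  ℚ[x]-integral : ∀ p q → p *ᵖ q ≈ᵖ 0ᵖ → p ≈ᵖ 0ᵖ ⊎ q ≈ᵖ 0ᵖ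
  ℚ[x]-integral []      q       = λ _ → inj₁ ≈-refl
  ℚ[x]-integral (a ∷ p) []      = λ _ → inj₂ ≈-refl
  ℚ[x]-integral (a ∷ p) (b ∷ q) =
    integral-step a p b q (ℚ[x]-integral p (b ∷ q)) (ℚ[x]-integral (a ∷ p) q)

open Polynomial public
  using (ℚ[x]; coeff; constant; X; ℚ[x]-commutativeRing)

module ℚ⟨x⟩ = Fractions ℚ[x]-commutativeRing Polynomial.1ᵖ≉0ᵖ Polynomial.ℚ[x]-integral

ℚ⟨x⟩-commutativeRing : CommutativeRing 0ℓ 0ℓ
ℚ⟨x⟩-commutativeRing = ℚ⟨x⟩.commutativeRing

ℚ[x]→ℚ⟨x⟩ : ℚ[x] → ℚ⟨x⟩.Fraction
ℚ[x]→ℚ⟨x⟩ = ℚ⟨x⟩.embed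

ℚ→ℚ⟨x⟩ : ℚ → ℚ⟨x⟩.Fraction
ℚ→ℚ⟨x⟩ a = ℚ⟨x⟩.embed (constant a)

module _ where
  open SemiringExp (CommutativeRing.semiring ℚ[x]-commutativeRing) using (_^_)

  X^≉0 : ∀ n → ¬ (X ^ n Polynomial.≈ᵖ Polynomial.0ᵖ)
  X^≉0 zero    = Polynomial.1ᵖ≉0ᵖ
  X^≉0 (suc n) = ℚ⟨x⟩.*-nonzero Polynomial.X≉0ᵖ (X^≉0 n)

  x^_ : ℤ → ℚ⟨x⟩.Fraction
  x^ (+ n)    = ℚ⟨x⟩.embed (X ^ n)
  x^ -[1+ n ] = ℚ⟨x⟩.frac Polynomial.1ᵖ (X ^ suc n) (X^≉0 (suc n))

module _ where
  open CommutativeRing ℚ[x]-commutativeRing using (-_; _+_; 0#; 1#)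
  open PowerSeries ℚ[x]-commutativeRing

  -- 1 - 2xt + t², as a series in t over ℚ[x].
  denominator : Series
  denominator 0 = 1#
  denominator 1 = - (X + X)
  denominator 2 = 1#
  denominator (suc (suc (suc _))) = 0#

  generating : Series
  generating = 1ˢ ÷ˢ denominator

  denominator*generating≋1 : denominator *ˢ generating ≋ 1ˢ
  denominator*generating≋1 =
    ÷ˢ-correct denominator 1ˢ (CommutativeRing.refl ℚ[x]-commutativeRing)

  U : ℕ → ℚ[x]
  U n = generating n

  U^[_] : ℕ → ℕ → ℚ[x]
  U^[ α ] n = (generating ^ˢ α) n

fromℕ : ℕ → ℚ
fromℕ n = + n ℚ./ 1

falling : ℚ → ℕ → ℚ
falling y zero    = 1ℚ
falling y (suc n) = falling y n ℚ.* (y ℚ.- fromℕ n)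

[2_-1]!! : ℕ → ℕ
[2 zero  -1]!! = 1
[2 suc k -1]!! = (2 ℕ.* suc k ∸ 1) ℕ.* [2 k -1]!!

_[_≔_] : (ℕ → ℕ) → ℕ → ℕ → (ℕ → ℕ)
(k [ m ≔ c ]) l = if l ≡ᵇ m then c else k l

module _ where
  open Summation ℚ.+-0-rawMonoid

  -- The iterated sum of f k over k m from 0 to M, k (m - 1) from 0 to
  -- M - k m, …, k 1 from 0 to M - k m - ⋯ - k 2.
  nestedSum : (m M : ℕ) → ((ℕ → ℕ) → ℚ) → ℚ
  nestedSum zero    M f = f (λ _ → 0)
  nestedSum (suc m) M f =
    ∑[ c ∈ 0 ⋯ M ] nestedSum m (M ∸ c) (λ k → f (k [ suc m ≔ c ]))

partialSum : (ℕ → ℕ) → ℕ → ℕ → ℕ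
partialSum k lo hi = ∑[ l ∈ lo ⋯ hi ] k l
  where open Summation ℕ.+-0-rawMonoid

aSummand : (i N : ℕ) → (ℕ → ℕ) → ℚ
aSummand i N k =
  fromℕ (2 ℕ.^ partialSum k 1 (i ∸ 1))
  ℚ.* (∏[ j ∈ 2 ⋯ i ]
         falling (fromℕ N ℚ.- fromℕ (partialSum k j (i ∸ 1))
                    ℚ.- (+ (2 ℕ.* i ℕ.+ 2) ℤ.- + j) ℚ./ 2)
                 (k (j ∸ 1)))
  ℚ.* fromℕ [2 N ∸ i ∸ partialSum k 1 (i ∸ 1) -1]!!
  where open Multiplication ℚ.*-1-rawMonoid

-- Meaningful for 1 ≤ i ≤ N only; then none of the subtractions ∸ on ℕ
-- is truncated. For i = 1 the value is (2N - 3)!! = (2(N - 1) - 1)!!.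
a : (i N : ℕ) → ℚ
a 0                N = 0ℚ
a 1                N = fromℕ [2 N ∸ 1 -1]!!
a i@(suc (suc _))  N = nestedSum (i ∸ 1) (N ∸ i) (aSummand i N)

prefactor : ℕ → ℚ
prefactor N = + 1 ℚ./ (2 ℕ.^ N ℕ.* N !)
  where
  instance
    _ = ℕₚ.m^n≢0 2 N
    _ = N ℕₚ.!≢0
    _ = ℕₚ.m*n≢0 (2 ℕ.^ N) (N !)

-- Let F = 1/(1 - 2xt + t²) and let ∂ be the derivative in t, so that
-- ∂F = 2 (x - t) F².  Hence, writing Y_m = (x - t)^{-(m+1)}, multiplication
-- by Y_0 after ∂ turns 2^N N! F^{N+1} into 2^{N+1} (N+1)! F^{N+2}, and by
-- induction 2^N N! F^{N+1} = Σ_i a_i(N) (x - t)^{i-2N} ∂^i F with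
--   a_i(N+1) = (2N - i) a_i(N) + a_{i-1}(N).
-- The nested sums satisfy the same recurrence: the outermost index c counts
-- how often the first summand is used before the second one, which gives
--   a_{i+1}(N) = Σ_c 2^c (N - (i+3)/2)_c a_i(N-1-c).
-- The theorem is the coefficient of t^n.

module Submission where

open import Defs
open import Algebra.Bundles using (CommutativeRing; Monoid)
import Algebra.Definitions.RawMonoid as RawMonoidDefs
import Algebra.Properties.CommutativeMonoid.Mult as CMult
import Algebra.Properties.Group as GroupProperties
import Algebra.Properties.Monoid.Sum as MonoidSum
import Algebra.Properties.Ring as RingProperties
import Algebra.Properties.Semiring.Exp as SemiringExp
import Algebra.Properties.Semiring.Mult as Mult
import Algebra.Properties.Semiring.Sum as SemiringSum
import Algebra.Solver.Ring.NaturalCoefficients.Default as SemiringSolver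
open import Data.Bool.Base using (if_then_else_; true; false)
open import Data.Fin.Base using (toℕ; zero; suc)
open import Data.Fin.Properties using (toℕ≤pred[n]; toℕ<n)
open import Data.Integer.Base as ℤ using (+_; -[1+_])
import Data.Integer.Properties as ℤₚ
import Data.Integer.Tactic.RingSolver as ℤSolver
open import Data.Nat.Base as ℕ using (ℕ; zero; suc; _∸_; _≤_; _<_; z≤n; s≤s; _!; _≡ᵇ_)
open import Data.Nat.Combinatorics using (_C_; nCk+nC[k+1]≡[n+1]C[k+1]; nCn≡1)
open import Data.Nat.Combinatorics.Base using (_P′_)
import Data.Nat.Properties as ℕₚ
import Data.Nat.Tactic.RingSolver as ℕSolver
open import Data.Product.Base using (_,_)
open import Data.Rational.Base as ℚ using (ℚ; 0ℚ; 1ℚ)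
import Data.Rational.Properties as ℚₚ
import Data.Rational.Solver as ℚSolver
import Data.Rational.Unnormalised.Base as ℚᵘ
import Data.Rational.Unnormalised.Properties as ℚᵘₚ
open import Data.Sum.Base using (inj₁; inj₂)
open import Function.Base using (_∘_)
open import Relation.Binary.PropositionalEquality as ≡ using (_≡_)
open import Relation.Binary.Structures using (IsEquivalence)
import Relation.Binary.Reasoning.Setoid as SetoidReasoning

-- The inverse of x - t is a power series in t only where x is a unit. The expansion therefore lives
-- over ℚ(x), applied to the images of the polynomials U_n; this is where the negative powers of x
-- come from. Taking Y_m as the explicit negative binomial series lets the summands of the theorem
-- be read off: Y_{2N-i-1} contributes the binomial coefficient and the power of x, and ∂^i F
-- contributes (l+i)_i U_{l+i}.
--
-- The obstacle is a_i(N), a nested sum of falling factorials of half-integers, whereas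
-- differentiation yields natural coefficients acting by repeated addition. The recurrence in N
-- holds for the nested sum because replacing N by N+1 and c by c+1 multiplies every term of the
-- outermost sum by the same number 2(N+1-(i+2)/2) = 2N-i, independent of c, while c = 0 leaves
-- a_{i-1}(N). The boundary i = N+1 needs its own argument, since the recurrence would refer there
-- to a_i(i-1), which is outside the meaningful range.

-- Formal power series as a commutative ring with a derivation.

module SeriesRing {c ℓ} (R : CommutativeRing c ℓ) where
  open CommutativeRing R
  open PowerSeries R
  open Mult semiring using (_×_; ×-congʳ; ×-assoc-*)
  open CMult +-commutativeMonoid using (×-distrib-+)
  open SemiringSolver commutativeSemiring using (solve; _:=_; _:+_; _:*_; con)
  private module ≈-R = SetoidReasoning setoid

  ≋-isEquivalence : IsEquivalence _≋_
  ≋-isEquivalence = record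
    { refl  = λ _ → refl
    ; sym   = λ e n → sym (e n)
    ; trans = λ e e′ n → trans (e n) (e′ n)
    }

  *ˢ-cong : ∀ {f f′ g g′} → f ≋ f′ → g ≋ g′ → f *ˢ g ≋ f′ *ˢ g′
  *ˢ-cong e e′ zero    = +-congʳ (*-cong (e 0) (e′ 0))
  *ˢ-cong e e′ (suc n) = +-cong (*-cong (e (suc n)) (e′ 0)) (*ˢ-cong e (e′ ∘ suc) n)

  *ˢ-zero : ∀ f g → (f *ˢ g) 0 ≈ f 0 * g 0
  *ˢ-zero f g = +-identityʳ _

  -- Unfolding the Cauchy product peels off the head of the right factor. This is the mirror image
  -- for the left factor, and the two together give commutativity.
  *ˢ-suc : ∀ f g n → (f *ˢ g) (suc n) ≈ f 0 * g (suc n) + ((f ∘ suc) *ˢ g) n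
  *ˢ-suc f g zero = solve 4 (λ a b c d →
      a :* b :+ (c :* d :+ con 0) := c :* d :+ (a :* b :+ con 0)) refl _ _ _ _
  *ˢ-suc f g (suc n) = begin
    f (suc (suc n)) * g 0 + (f *ˢ (g ∘ suc)) (suc n)
      ≈⟨ +-congˡ (*ˢ-suc f (g ∘ suc) n) ⟩
    f (suc (suc n)) * g 0 + (f 0 * g (suc (suc n)) + ((f ∘ suc) *ˢ (g ∘ suc)) n)
      ≈⟨ solve 3 (λ a b c → a :+ (b :+ c) := b :+ (a :+ c)) refl _ _ _ ⟩
    f 0 * g (suc (suc n)) + ((f ∘ suc) *ˢ g) (suc n) ∎
    where open ≈-R

  *ˢ-comm : ∀ f g → f *ˢ g ≋ g *ˢ f
  *ˢ-comm f g zero    = +-congʳ (*-comm _ _)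
  *ˢ-comm f g (suc n) = trans (+-cong (*-comm _ _) (*ˢ-comm f (g ∘ suc) n))
    (sym (*ˢ-suc g f n))

  *ˢ-distribˡ : ∀ f g h → f *ˢ (g +ˢ h) ≋ f *ˢ g +ˢ f *ˢ h
  *ˢ-distribˡ f g h zero    = solve 3 (λ a b c →
      a :* (b :+ c) :+ con 0 := (a :* b :+ con 0) :+ (a :* c :+ con 0)) refl _ _ _
  *ˢ-distribˡ f g h (suc n) = trans (+-congˡ (*ˢ-distribˡ f (g ∘ suc) (h ∘ suc) n))
    (solve 5 (λ a b c d e →
      a :* (b :+ c) :+ (d :+ e) := (a :* b :+ d) :+ (a :* c :+ e)) refl _ _ _ _ _)

  *ˢ-distribʳ : ∀ f g h → (g +ˢ h) *ˢ f ≋ g *ˢ f +ˢ h *ˢ f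
  *ˢ-distribʳ f g h n = begin
    ((g +ˢ h) *ˢ f) n          ≈⟨ *ˢ-comm (g +ˢ h) f n ⟩
    (f *ˢ (g +ˢ h)) n          ≈⟨ *ˢ-distribˡ f g h n ⟩
    (f *ˢ g) n + (f *ˢ h) n    ≈⟨ +-cong (*ˢ-comm f g n) (*ˢ-comm f h n) ⟩
    (g *ˢ f) n + (h *ˢ f) n    ∎
    where open ≈-R

  infixr 7 _·ˢ_
  _·ˢ_ : Carrier → Series → Series
  (a ·ˢ f) n = a * f n

  *ˢ-·ˢ : ∀ f a g → f *ˢ (a ·ˢ g) ≋ a ·ˢ (f *ˢ g)
  *ˢ-·ˢ f a g zero    = solve 3 (λ f a g →
      f :* (a :* g) :+ con 0 := a :* (f :* g :+ con 0)) refl _ _ _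
  *ˢ-·ˢ f a g (suc n) = trans (+-congˡ (*ˢ-·ˢ f a (g ∘ suc) n))
    (solve 4 (λ f a g h → f :* (a :* g) :+ a :* h := a :* (f :* g :+ h)) refl _ _ _ _)

  *ˢ-assoc : ∀ f g h → (f *ˢ g) *ˢ h ≋ f *ˢ (g *ˢ h)
  *ˢ-assoc f g h zero    = solve 3 (λ f g h →
      (f :* g :+ con 0) :* h :+ con 0 := f :* (g :* h :+ con 0) :+ con 0) refl _ _ _
  *ˢ-assoc f g h (suc n) = begin
    (f (suc n) * g 0 + (f *ˢ (g ∘ suc)) n) * h 0 + ((f *ˢ g) *ˢ (h ∘ suc)) n
      ≈⟨ +-congˡ (*ˢ-assoc f g (h ∘ suc) n) ⟩
    (f (suc n) * g 0 + (f *ˢ (g ∘ suc)) n) * h 0 + (f *ˢ (g *ˢ (h ∘ suc))) n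
      ≈⟨ solve 5 (λ f g k h e →
           (f :* g :+ k) :* h :+ e := f :* (g :* h :+ con 0) :+ (h :* k :+ e))
           refl _ _ _ _ _ ⟩
    f (suc n) * (g *ˢ h) 0 + (h 0 * (f *ˢ (g ∘ suc)) n + (f *ˢ (g *ˢ (h ∘ suc))) n)
      ≈⟨ +-congˡ (+-congʳ (*ˢ-·ˢ f (h 0) (g ∘ suc) n)) ⟨
    f (suc n) * (g *ˢ h) 0 + ((f *ˢ (h 0 ·ˢ (g ∘ suc))) n + (f *ˢ (g *ˢ (h ∘ suc))) n)
      ≈⟨ +-congˡ (*ˢ-distribˡ f (h 0 ·ˢ (g ∘ suc)) (g *ˢ (h ∘ suc)) n) ⟨
    f (suc n) * (g *ˢ h) 0 + (f *ˢ ((h 0 ·ˢ (g ∘ suc)) +ˢ g *ˢ (h ∘ suc))) n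
      ≈⟨ +-congˡ (*ˢ-cong {f} {f} (λ _ → refl)
           (λ k → +-congʳ {(g *ˢ (h ∘ suc)) k} (*-comm (h 0) (g (suc k)))) n) ⟩
    f (suc n) * (g *ˢ h) 0 + (f *ˢ ((g *ˢ h) ∘ suc)) n ∎
    where open ≈-R

  *ˢ-identityˡ : ∀ f → 1ˢ *ˢ f ≋ f
  *ˢ-identityˡ f zero    = trans (+-identityʳ _) (*-identityˡ _)
  *ˢ-identityˡ f (suc n) = begin
    0# * f 0 + (1ˢ *ˢ (f ∘ suc)) n  ≈⟨ +-cong (zeroˡ _) (*ˢ-identityˡ (f ∘ suc) n) ⟩
    0# + f (suc n)                  ≈⟨ +-identityˡ _ ⟩
    f (suc n)                       ∎
    where open ≈-R

  *ˢ-identityʳ : ∀ f → f *ˢ 1ˢ ≋ f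
  *ˢ-identityʳ f n = trans (*ˢ-comm f 1ˢ n) (*ˢ-identityˡ f n)

  seriesRing : CommutativeRing c ℓ
  seriesRing = record
    { Carrier = Series
    ; _≈_ = _≋_ ; _+_ = _+ˢ_ ; _*_ = _*ˢ_ ; -_ = λ f n → - f n ; 0# = 0ˢ ; 1# = 1ˢ
    ; isCommutativeRing = record
      { isRing = record
        { +-isAbelianGroup = record
          { isGroup = record
            { isMonoid = record
              { isSemigroup = record
                { isMagma = record
                  { isEquivalence = ≋-isEquivalence
                  ; ∙-cong = λ e e′ n → +-cong (e n) (e′ n)
                  }
                ; assoc = λ f g h n → +-assoc (f n) (g n) (h n)
                }
              ; identity = (λ f n → +-identityˡ (f n)) , (λ f n → +-identityʳ (f n))
              }
            ; inverse = (λ f n → -‿inverseˡ (f n)) , (λ f n → -‿inverseʳ (f n))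
            ; ⁻¹-cong = λ e n → -‿cong (e n)
            }
          ; comm = λ f g n → +-comm (f n) (g n)
          }
        ; *-cong = *ˢ-cong
        ; *-assoc = *ˢ-assoc
        ; *-identity = *ˢ-identityˡ , *ˢ-identityʳ
        ; distrib = *ˢ-distribˡ , *ˢ-distribʳ
        }
      ; *-comm = *ˢ-comm
      }
    }

  ∂ : Series → Series
  ∂ f n = suc n × f (suc n)

  ∂-cong : ∀ {f g} → f ≋ g → ∂ f ≋ ∂ g
  ∂-cong e n = ×-congʳ (suc n) (e (suc n))

  ∂-+ˢ : ∀ f g → ∂ (f +ˢ g) ≋ ∂ f +ˢ ∂ g
  ∂-+ˢ f g n = ×-distrib-+ (f (suc n)) (g (suc n)) (suc n)

  ∂-*ˢ : ∀ f g → ∂ (f *ˢ g) ≋ ∂ f *ˢ g +ˢ f *ˢ ∂ g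
  ∂-*ˢ f g zero    = solve 4 (λ f₀ g₀ f₁ g₁ →
      (f₁ :* g₀ :+ (f₀ :* g₁ :+ con 0)) :+ con 0
      := ((f₁ :+ con 0) :* g₀ :+ con 0) :+ (f₀ :* (g₁ :+ con 0) :+ con 0))
      refl (f 0) (g 0) (f 1) (g 1)
  ∂-*ˢ f g (suc n) = begin
    (2 ℕ.+ n) × (f₂ * g 0 + p)
      ≈⟨ ×-distrib-+ (f₂ * g 0) p (suc (suc n)) ⟩
    -- Of the n + 2 copies of `p`, all but one form a derivative to which the induction hypothesis
    -- applies. The remaining copy makes up for the difference between `∂ g ∘ suc` and
    -- `∂ (g ∘ suc)`, which is g shifted by two.
    (2 ℕ.+ n) × (f₂ * g 0) + (p + ∂ (f *ˢ (g ∘ suc)) n)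
      ≈⟨ +-cong (sym (×-assoc-* (suc (suc n)) _ _)) (+-congˡ (∂-*ˢ f (g ∘ suc) n)) ⟩
    (2 ℕ.+ n) × f₂ * g 0 + (p + (q + (f *ˢ ∂ (g ∘ suc)) n))
      ≈⟨ solve 6 (λ a f₁ g₁ r q s →
           a :+ ((f₁ :* g₁ :+ r) :+ (q :+ s))
           := (a :+ q) :+ (f₁ :* (g₁ :+ con 0) :+ (r :+ s)))
           refl _ (f (suc n)) (g 1) r q _ ⟩
    ((2 ℕ.+ n) × f₂ * g 0 + q) + (f (suc n) * (1 × g 1) + (r + (f *ˢ ∂ (g ∘ suc)) n))
      ≈⟨ +-congˡ (+-congˡ (*ˢ-distribˡ f (λ k → g (suc (suc k))) (∂ (g ∘ suc)) n)) ⟨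
    (∂ f *ˢ g) (suc n) + (f *ˢ ∂ g) (suc n) ∎
    where
    open ≈-R
    f₂ = f (suc (suc n))
    p = (f *ˢ (g ∘ suc)) (suc n)
    q = (∂ f *ˢ (g ∘ suc)) n
    r = (f *ˢ (λ k → g (suc (suc k)))) n

-- The coefficients as natural numbers, and their normalisation.

-- β N j is a_{j+1}(N+1): differentiating the expansion of F^{N+2} in
-- Derivation.powerExpansion produces exactly this recurrence.
β : ℕ → ℕ → ℕ
β zero    zero    = 1
β zero    (suc j) = 0
β (suc N) zero    = suc (2 ℕ.* N) ℕ.* β N zero
β (suc N) (suc j) = (2 ℕ.* N ∸ j) ℕ.* β N (suc j) ℕ.+ β N j

-- Whenever `2 * N ∸ j` is truncated, it multiplies one of these zeros, so `β` obeys the recurrence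
-- over the integers as well. The zeros also close the shifted sum for F^{N+2} and the diagonal case
-- of the nested sums.
β-vanishes : ∀ {N j} → N < j → β N j ≡ 0
β-vanishes {zero}  {suc j} _ = ≡.refl
β-vanishes {suc N} {suc j} (s≤s N<j)
  rewrite β-vanishes {N} {suc j} (ℕₚ.m≤n⇒m≤1+n N<j) | β-vanishes N<j =
  ≡.trans (ℕₚ.+-identityʳ _) (ℕₚ.*-zeroʳ (2 ℕ.* N ∸ j))

normaliser : ℕ → ℕ
normaliser N = 2 ℕ.^ N ℕ.* N !

normaliser-suc : ∀ N → normaliser (suc N) ≡ 2 ℕ.* suc N ℕ.* normaliser N
normaliser-suc N = lemma (2 ℕ.^ N) N (N !)
  where
  lemma : ∀ p N q → 2 ℕ.* p ℕ.* (suc N ℕ.* q) ≡ 2 ℕ.* suc N ℕ.* (p ℕ.* q)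
  lemma = ℕSolver.solve-∀

module _ {c ℓ} (M : Monoid c ℓ) where
  open Monoid M
  open RawMonoidDefs rawMonoid using (sum)

  -- Sums unfold at their first index, but the outermost variable of the nested sums has the last
  -- one. A general monoid covers ring sums, sums of naturals and products of rationals alike.
  sum-last : ∀ n (f : ℕ → Carrier) →
    sum {suc n} (λ j → f (toℕ j)) ≈ sum {n} (λ j → f (toℕ j)) ∙ f n
  sum-last zero    f = trans (identityʳ (f 0)) (sym (identityˡ (f 0)))
  sum-last (suc n) f = trans (∙-congˡ (sum-last n (λ j → f (suc j)))) (sym (assoc _ _ _))

-- Powers of F through iterated derivatives, in a ring with a derivation.

module _ {c ℓ} (S : CommutativeRing c ℓ) where
  open CommutativeRing S

  module Derivation
    (∂ : Carrier → Carrier)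
    (∂-cong : ∀ {f g} → f ≈ g → ∂ f ≈ ∂ g)
    (∂-+ : ∀ f g → ∂ (f + g) ≈ ∂ f + ∂ g)
    (∂-* : ∀ f g → ∂ (f * g) ≈ ∂ f * g + f * ∂ g)
    where

    open GroupProperties +-group using (identityʳ-unique)
    open CMult +-commutativeMonoid using (×-distrib-+)
    open Mult semiring using (_×_; ×-congʳ; ×-congˡ; ×-cong; ×-homo-+; ×-assocˡ; ×-comm-*; ×-assoc-*)
    open SemiringExp semiring using (_^_)
    open SemiringSum semiring using (sum; sum-cong-≋; ∑-distrib-+; *-distribˡ-sum)
    open SemiringSolver commutativeSemiring using (solve; _:=_; _:+_; _:*_; con)
    open SetoidReasoning setoid

    ∂-0# : ∂ 0# ≈ 0#
    ∂-0# = identityʳ-unique (∂ 0#) (∂ 0#)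
      (trans (sym (∂-+ 0# 0#)) (∂-cong (+-identityˡ 0#)))

    ∂-1# : ∂ 1# ≈ 0#
    ∂-1# = identityʳ-unique (∂ 1#) (∂ 1#) (begin
      ∂ 1# + ∂ 1#            ≈⟨ +-cong (*-identityʳ _) (*-identityˡ _) ⟨
      ∂ 1# * 1# + 1# * ∂ 1#  ≈⟨ ∂-* 1# 1# ⟨
      ∂ (1# * 1#)            ≈⟨ ∂-cong (*-identityˡ 1#) ⟩
      ∂ 1#                   ∎)

    ∂-× : ∀ n f → ∂ (n × f) ≈ n × ∂ f
    ∂-× zero    f = ∂-0#
    ∂-× (suc n) f = trans (∂-+ f (n × f)) (+-congˡ (∂-× n f))

    ∂-^ : ∀ f n → ∂ (f ^ suc n) ≈ suc n × (f ^ n * ∂ f)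
    ∂-^ f zero = begin
      ∂ (f * 1#)                ≈⟨ ∂-cong (*-identityʳ f) ⟩
      ∂ f                       ≈⟨ solve 1 (λ f → f := con 1 :* f :+ con 0) refl (∂ f) ⟩
      1# * ∂ f + 0#             ∎
    ∂-^ f (suc n) = begin
      ∂ (f * f ^ suc n)
        ≈⟨ ∂-* f (f ^ suc n) ⟩
      ∂ f * f ^ suc n + f * ∂ (f ^ suc n)
        ≈⟨ +-cong (*-comm _ _) (*-congˡ (∂-^ f n)) ⟩
      f ^ suc n * ∂ f + f * (suc n × (f ^ n * ∂ f))
        ≈⟨ +-congˡ (×-comm-* (suc n) f _) ⟩
      f ^ suc n * ∂ f + suc n × (f * (f ^ n * ∂ f))
        ≈⟨ +-congˡ (×-congʳ (suc n) (*-assoc f (f ^ n) (∂ f))) ⟨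
      f ^ suc n * ∂ f + suc n × (f ^ suc n * ∂ f) ∎

    -- Obtained by differentiating d f = 1. The hypothesis on `∂ d` is a sum equal to zero rather
    -- than ∂d = -2w, so that everything stays within commutative semiring identities.
    ∂-inverse : ∀ w d f → d * f ≈ 1# → ∂ d + (w + w) ≈ 0# → ∂ f ≈ 2 × (w * (f * f))
    ∂-inverse w d f df≈1 ∂d+2w≈0 = begin
      ∂ f
        ≈⟨ *-identityˡ (∂ f) ⟨
      1# * ∂ f
        ≈⟨ *-congʳ df≈1 ⟨
      d * f * ∂ f
        ≈⟨ solve 3 (λ d f e → d :* f :* e := f :* (d :* e) :+ con 0 :* (f :* f)) refl _ _ _ ⟩
      -- The zero is inserted in order to be traded for `∂ d + (w + w)`: its part `∂ d` completes
      -- the Leibniz expansion of `∂ (d * f)`, and its part `w + w` is the result.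
      f * (d * ∂ f) + 0# * (f * f)
        ≈⟨ +-congˡ (*-congʳ ∂d+2w≈0) ⟨
      f * (d * ∂ f) + (∂ d + (w + w)) * (f * f)
        ≈⟨ solve 5 (λ d f e w d′ → f :* (d :* e) :+ (d′ :+ (w :+ w)) :* (f :* f)
             := f :* (d′ :* f :+ d :* e) :+ (w :* (f :* f) :+ (w :* (f :* f) :+ con 0)))
             refl d f (∂ f) w (∂ d) ⟩
      f * (∂ d * f + d * ∂ f) + 2 × (w * (f * f))
        ≈⟨ +-congʳ (*-congˡ (trans (sym (∂-* d f)) (trans (∂-cong df≈1) ∂-1#))) ⟩
      f * 0# + 2 × (w * (f * f))
        ≈⟨ +-congʳ (zeroʳ f) ⟩
      0# + 2 × (w * (f * f))
        ≈⟨ +-identityˡ _ ⟩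
      2 × (w * (f * f)) ∎

    ∂-sum : ∀ {n} (f : _ → Carrier) → ∂ (sum {n} f) ≈ sum {n} (λ j → ∂ (f j))
    ∂-sum {zero}  f = ∂-0#
    ∂-sum {suc n} f = trans (∂-+ _ _) (+-congˡ (∂-sum {n} (λ j → f (suc j))))

    ∂^ : ℕ → Carrier → Carrier
    ∂^ zero    f = f
    ∂^ (suc n) f = ∂ (∂^ n f)

    -- Y m plays the role of w^{-(m+1)}.
    module _ (w F : Carrier) (Y : ℕ → Carrier)
      (∂F : ∂ F ≈ 2 × (w * (F * F)))
      (wY₀ : w * Y 0 ≈ 1#)
      (wY : ∀ m → w * Y (suc m) ≈ Y m)
      (∂Y : ∀ m → ∂ (Y m) ≈ suc m × Y (suc m))
      where

      -- Exponents add although no powers of an inverse are at hand: write Y_m as w Y_{m+1} and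
      -- cancel w against Y_0.
      Y₀*Y : ∀ m → Y 0 * Y m ≈ Y (suc m)
      Y₀*Y m = begin
        Y 0 * Y m               ≈⟨ *-congˡ (wY m) ⟨
        Y 0 * (w * Y (suc m))   ≈⟨ solve 3 (λ y w z → y :* (w :* z) := (w :* y) :* z) refl _ _ _ ⟩
        w * Y 0 * Y (suc m)     ≈⟨ *-congʳ wY₀ ⟩
        1# * Y (suc m)          ≈⟨ *-identityˡ _ ⟩
        Y (suc m)               ∎

      Y₀*∂F : Y 0 * ∂ F ≈ 2 × (F * F)
      Y₀*∂F = begin
        Y 0 * ∂ F                  ≈⟨ *-congˡ ∂F ⟩
        Y 0 * (2 × (w * (F * F)))  ≈⟨ ×-comm-* 2 _ _ ⟩
        2 × (Y 0 * (w * (F * F)))  ≈⟨ ×-congʳ 2 (solve 3 (λ y w z → y :* (w :* z) := (w :* y) :* z) refl _ _ _) ⟩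
        2 × (w * Y 0 * (F * F))    ≈⟨ ×-congʳ 2 (trans (*-congʳ wY₀) (*-identityˡ _)) ⟩
        2 × (F * F)                ∎

      Y₀*∂F^ : ∀ n → Y 0 * ∂ (F ^ suc n) ≈ (2 ℕ.* suc n) × F ^ suc (suc n)
      Y₀*∂F^ n = begin
        Y 0 * ∂ (F ^ suc n)              ≈⟨ *-congˡ (∂-^ F n) ⟩
        Y 0 * (suc n × (F ^ n * ∂ F))    ≈⟨ ×-comm-* (suc n) _ _ ⟩
        suc n × (Y 0 * (F ^ n * ∂ F))    ≈⟨ ×-congʳ (suc n) (solve 3 (λ y z f → y :* (z :* f) := z :* (y :* f)) refl _ _ _) ⟩
        suc n × (F ^ n * (Y 0 * ∂ F))    ≈⟨ ×-congʳ (suc n) (*-congˡ Y₀*∂F) ⟩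
        suc n × (F ^ n * (2 × (F * F)))  ≈⟨ ×-congʳ (suc n) (×-comm-* 2 _ _) ⟩
        suc n × (2 × (F ^ n * (F * F)))  ≈⟨ ×-assocˡ _ (suc n) 2 ⟩
        (suc n ℕ.* 2) × (F ^ n * (F * F)) ≈⟨ ×-cong (ℕₚ.*-comm (suc n) 2)
                                              (solve 2 (λ z f → z :* (f :* f) := f :* (f :* z)) refl _ _) ⟩
        (2 ℕ.* suc n) × F ^ suc (suc n)  ∎

      term : ℕ → ℕ → Carrier
      term N j = Y (2 ℕ.* N ∸ j) * ∂^ (suc j) F

      expansion : ℕ → Carrier
      expansion N = sum {suc N} (λ j → β N (toℕ j) × term N (toℕ j))

      -- By Leibniz, with m = 2N - j: differentiating Y_m gives (m+1) Y_{m+1}, which Y_0 lifts to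
      -- Y_{m+2}, and m + 2 = 2(N+1) - j. Differentiating the other factor leaves Y_{m+1}, and m + 1
      -- = 2(N+1) - (j+1). The bound on j keeps these subtractions from being truncated.
      Y₀*∂term : ∀ {N j} → j ≤ N →
        Y 0 * ∂ (term N j) ≈ (suc (2 ℕ.* N) ∸ j) × term (suc N) j + term (suc N) (suc j)
      Y₀*∂term {N} {j} j≤N = begin
        Y 0 * ∂ (Y m * ∂^ (suc j) F)
          ≈⟨ *-congˡ (∂-* (Y m) _) ⟩
        Y 0 * (∂ (Y m) * ∂^ (suc j) F + Y m * ∂^ (suc (suc j)) F)
          ≈⟨ *-congˡ (+-congʳ (*-congʳ (∂Y m))) ⟩
        Y 0 * ((suc m × Y (suc m)) * ∂^ (suc j) F + Y m * ∂^ (suc (suc j)) F)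
          ≈⟨ *-congˡ (+-congʳ (×-assoc-* (suc m) _ _)) ⟩
        Y 0 * (suc m × (Y (suc m) * ∂^ (suc j) F) + Y m * ∂^ (suc (suc j)) F)
          ≈⟨ distribˡ _ _ _ ⟩
        Y 0 * (suc m × (Y (suc m) * ∂^ (suc j) F)) + Y 0 * (Y m * ∂^ (suc (suc j)) F)
          ≈⟨ +-cong (×-comm-* (suc m) _ _) (sym (*-assoc _ _ _)) ⟩
        suc m × (Y 0 * (Y (suc m) * ∂^ (suc j) F)) + Y 0 * Y m * ∂^ (suc (suc j)) F
          ≈⟨ +-cong (×-congʳ (suc m) (sym (*-assoc _ _ _))) (*-congʳ (Y₀*Y m)) ⟩
        suc m × (Y 0 * Y (suc m) * ∂^ (suc j) F) + Y (suc m) * ∂^ (suc (suc j)) F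
          ≈⟨ +-congʳ (×-congʳ (suc m) (*-congʳ (Y₀*Y (suc m)))) ⟩
        suc m × (Y (suc (suc m)) * ∂^ (suc j) F) + Y (suc m) * ∂^ (suc (suc j)) F
          ≡⟨ ≡.cong₂ _+_ (≡.cong₂ (λ a b → a × (Y b * ∂^ (suc j) F)) (≡.sym e₁) (≡.sym e₂))
               (≡.cong (λ a → Y a * ∂^ (suc (suc j)) F) (≡.sym e₃)) ⟩
        (suc (2 ℕ.* N) ∸ j) × term (suc N) j + term (suc N) (suc j) ∎
        where
        m = 2 ℕ.* N ∸ j
        j≤2N : j ≤ 2 ℕ.* N
        j≤2N = ℕₚ.≤-trans j≤N (ℕₚ.m≤m+n N _)
        e₁ : suc (2 ℕ.* N) ∸ j ≡ suc m
        e₁ = ℕₚ.+-∸-assoc 1 j≤2N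
        e₂ : 2 ℕ.* suc N ∸ j ≡ suc (suc m)
        e₂ = ≡.trans (≡.cong (_∸ j) (ℕₚ.*-suc 2 N)) (ℕₚ.+-∸-assoc 2 j≤2N)
        e₃ : 2 ℕ.* suc N ∸ suc j ≡ suc m
        e₃ = ≡.trans (≡.cong (_∸ suc j) (ℕₚ.*-suc 2 N)) e₁

      Y₀*∂expansion : ∀ N → Y 0 * ∂ (expansion N) ≈ expansion (suc N)
      Y₀*∂expansion N = begin
        Y 0 * ∂ (expansion N)
          ≈⟨ *-congˡ (∂-sum {suc N} (λ j → β N (toℕ j) × term N (toℕ j))) ⟩
        Y 0 * sum {suc N} (λ j → ∂ (β N (toℕ j) × term N (toℕ j)))
          ≈⟨ *-distribˡ-sum {suc N} (Y 0) (λ j → ∂ (β N (toℕ j) × term N (toℕ j))) ⟩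
        sum {suc N} (λ j → Y 0 * ∂ (β N (toℕ j) × term N (toℕ j)))
          ≈⟨ sum-cong-≋ {suc N} (λ j → summand (toℕ j) (toℕ≤pred[n] j)) ⟩
        sum {suc N} (λ j → u (toℕ j) + v (toℕ j))
          ≈⟨ ∑-distrib-+ {suc N} (λ j → u (toℕ j)) (λ j → v (toℕ j)) ⟩
        sum {suc N} (λ j → u (toℕ j)) + sum {suc N} (λ j → v (toℕ j))
          ≈⟨ +-congʳ (+-identityʳ _) ⟨
        -- The two families contribute to the terms j and j + 1. Extending `u` by its vanishing
        -- value at N + 1 and splitting off `u 0` aligns the indices, after which the summands are
        -- those of `β (suc N)` by definition.
        sum {suc N} (λ j → u (toℕ j)) + 0# + sum {suc N} (λ j → v (toℕ j))
          ≈⟨ +-congʳ (+-congˡ u-last) ⟨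
        sum {suc N} (λ j → u (toℕ j)) + u (suc N) + sum {suc N} (λ j → v (toℕ j))
          ≈⟨ +-congʳ (sum-last +-monoid (suc N) u) ⟨
        u 0 + sum {suc N} (λ j → u (suc (toℕ j))) + sum {suc N} (λ j → v (toℕ j))
          ≈⟨ +-assoc _ _ _ ⟩
        u 0 + (sum {suc N} (λ j → u (suc (toℕ j))) + sum {suc N} (λ j → v (toℕ j)))
          ≈⟨ +-congˡ (∑-distrib-+ {suc N} (λ j → u (suc (toℕ j))) (λ j → v (toℕ j))) ⟨
        u 0 + sum {suc N} (λ j → u (suc (toℕ j)) + v (toℕ j))
          ≈⟨ +-congˡ (sum-cong-≋ {suc N} (λ j →
               ×-homo-+ (term (suc N) (suc (toℕ j))) ((2 ℕ.* N ∸ toℕ j) ℕ.* β N (suc (toℕ j))) (β N (toℕ j)))) ⟨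
        expansion (suc N) ∎
        where
        u v : ℕ → Carrier
        u j = ((suc (2 ℕ.* N) ∸ j) ℕ.* β N j) × term (suc N) j
        v j = β N j × term (suc N) (suc j)

        u-last : u (suc N) ≈ 0#
        u-last = ×-congˡ {term (suc N) (suc N)} (≡.trans
          (≡.cong ((2 ℕ.* N ∸ N) ℕ.*_) (β-vanishes {N} ℕₚ.≤-refl)) (ℕₚ.*-zeroʳ (2 ℕ.* N ∸ N)))

        summand : ∀ j → j ≤ N → Y 0 * ∂ (β N j × term N j) ≈ u j + v j
        summand j j≤N = begin
          Y 0 * ∂ (β N j × term N j)
            ≈⟨ *-congˡ (∂-× (β N j) _) ⟩
          Y 0 * (β N j × ∂ (term N j))
            ≈⟨ ×-comm-* (β N j) _ _ ⟩
          β N j × (Y 0 * ∂ (term N j))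
            ≈⟨ ×-congʳ (β N j) (Y₀*∂term j≤N) ⟩
          β N j × ((suc (2 ℕ.* N) ∸ j) × term (suc N) j + term (suc N) (suc j))
            ≈⟨ ×-distrib-+ _ _ (β N j) ⟩
          β N j × ((suc (2 ℕ.* N) ∸ j) × term (suc N) j) + v j
            ≈⟨ +-congʳ (×-assocˡ _ (β N j) (suc (2 ℕ.* N) ∸ j)) ⟩
          (β N j ℕ.* (suc (2 ℕ.* N) ∸ j)) × term (suc N) j + v j
            ≈⟨ +-congʳ (×-congˡ (ℕₚ.*-comm (β N j) _)) ⟩
          u j + v j ∎

      powerExpansion : ∀ N → normaliser (suc N) × F ^ suc (suc N) ≈ expansion N
      powerExpansion zero = begin
        2 × (F * (F * 1#))        ≈⟨ ×-congʳ 2 (*-congˡ (*-identityʳ F)) ⟩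
        2 × (F * F)               ≈⟨ Y₀*∂F ⟨
        Y 0 * ∂ F                 ≈⟨ trans (+-identityʳ _) (+-identityʳ _) ⟨
        (Y 0 * ∂ F + 0#) + 0#     ∎
      powerExpansion (suc N) = begin
        normaliser (suc (suc N)) × F ^ suc (suc (suc N))
          ≈⟨ ×-congˡ (≡.trans (normaliser-suc (suc N)) (ℕₚ.*-comm (2 ℕ.* suc (suc N)) (normaliser (suc N)))) ⟩
        (normaliser (suc N) ℕ.* (2 ℕ.* suc (suc N))) × F ^ suc (suc (suc N))
          ≈⟨ ×-assocˡ _ (normaliser (suc N)) (2 ℕ.* suc (suc N)) ⟨
        normaliser (suc N) × ((2 ℕ.* suc (suc N)) × F ^ suc (suc (suc N)))
          ≈⟨ ×-congʳ (normaliser (suc N)) (Y₀*∂F^ (suc N)) ⟨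
        normaliser (suc N) × (Y 0 * ∂ (F ^ suc (suc N)))
          ≈⟨ ×-comm-* (normaliser (suc N)) _ _ ⟨
        Y 0 * (normaliser (suc N) × ∂ (F ^ suc (suc N)))
          ≈⟨ *-congˡ (∂-× (normaliser (suc N)) _) ⟨
        Y 0 * ∂ (normaliser (suc N) × F ^ suc (suc N))
          ≈⟨ *-congˡ (∂-cong (powerExpansion N)) ⟩
        Y 0 * ∂ (expansion N)
          ≈⟨ Y₀*∂expansion N ⟩
        expansion (suc N) ∎

-- Absorption identities for binomial coefficients.

[k+1]*[n+1]C[k+1]≡[n+1]*nCk : ∀ n k → suc k ℕ.* (suc n C suc k) ≡ suc n ℕ.* (n C k)
[k+1]*[n+1]C[k+1]≡[n+1]*nCk zero    zero    = ≡.refl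
[k+1]*[n+1]C[k+1]≡[n+1]*nCk zero    (suc k) = ℕₚ.*-zeroʳ (suc (suc k))
[k+1]*[n+1]C[k+1]≡[n+1]*nCk (suc n) zero    = begin
  1 ℕ.* (suc (suc n) C 1)                      ≡⟨ ≡.cong (1 ℕ.*_) (nCk+nC[k+1]≡[n+1]C[k+1] (suc n) 0) ⟨
  1 ℕ.* (1 ℕ.+ (suc n C 1))                    ≡⟨ lemma (suc n C 1) ⟩
  1 ℕ.+ 1 ℕ.* (suc n C 1)                      ≡⟨ ≡.cong suc ([k+1]*[n+1]C[k+1]≡[n+1]*nCk n 0) ⟩
  suc (suc n) ℕ.* 1                            ∎
  where
  open ≡.≡-Reasoning
  lemma : ∀ c → 1 ℕ.* (1 ℕ.+ c) ≡ 1 ℕ.+ 1 ℕ.* c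
  lemma = ℕSolver.solve-∀
[k+1]*[n+1]C[k+1]≡[n+1]*nCk (suc n) (suc k) = begin
  suc (suc k) ℕ.* (suc (suc n) C suc (suc k))
    ≡⟨ ≡.cong (suc (suc k) ℕ.*_) (nCk+nC[k+1]≡[n+1]C[k+1] (suc n) (suc k)) ⟨
  suc (suc k) ℕ.* (c ℕ.+ d)
    ≡⟨ regroup k c d ⟩
  suc k ℕ.* c ℕ.+ suc (suc k) ℕ.* d ℕ.+ c
    ≡⟨ ≡.cong (ℕ._+ c) (≡.cong₂ ℕ._+_
         ([k+1]*[n+1]C[k+1]≡[n+1]*nCk n k) ([k+1]*[n+1]C[k+1]≡[n+1]*nCk n (suc k))) ⟩
  suc n ℕ.* (n C k) ℕ.+ suc n ℕ.* (n C suc k) ℕ.+ c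
    ≡⟨ ≡.cong (ℕ._+ c) (ℕₚ.*-distribˡ-+ (suc n) (n C k) (n C suc k)) ⟨
  suc n ℕ.* (n C k ℕ.+ n C suc k) ℕ.+ c
    ≡⟨ ≡.cong (λ z → suc n ℕ.* z ℕ.+ c) (nCk+nC[k+1]≡[n+1]C[k+1] n k) ⟩
  suc n ℕ.* c ℕ.+ c
    ≡⟨ ℕₚ.+-comm (suc n ℕ.* c) c ⟩
  suc (suc n) ℕ.* c ∎
  where
  open ≡.≡-Reasoning
  c = suc n C suc k
  d = suc n C suc (suc k)
  regroup : ∀ k c d → suc (suc k) ℕ.* (c ℕ.+ d) ≡ suc k ℕ.* c ℕ.+ suc (suc k) ℕ.* d ℕ.+ c
  regroup = ℕSolver.solve-∀

[k+1]*[1+m+k]C[k+1]≡[m+1]*[1+m+k]Ck : ∀ m k →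
  suc k ℕ.* (suc (m ℕ.+ k) C suc k) ≡ suc m ℕ.* (suc (m ℕ.+ k) C k)
[k+1]*[1+m+k]C[k+1]≡[m+1]*[1+m+k]Ck m k = ℕₚ.+-cancelˡ-≡ (suc k ℕ.* p) _ _ (begin
  suc k ℕ.* p ℕ.+ suc k ℕ.* q              ≡⟨ ℕₚ.*-distribˡ-+ (suc k) p q ⟨
  suc k ℕ.* (p ℕ.+ q)                      ≡⟨ ≡.cong (suc k ℕ.*_) (nCk+nC[k+1]≡[n+1]C[k+1] (suc (m ℕ.+ k)) k) ⟩
  suc k ℕ.* (suc (suc (m ℕ.+ k)) C suc k)  ≡⟨ [k+1]*[n+1]C[k+1]≡[n+1]*nCk (suc (m ℕ.+ k)) k ⟩
  suc (suc (m ℕ.+ k)) ℕ.* p                ≡⟨ split m k p ⟩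
  suc k ℕ.* p ℕ.+ suc m ℕ.* p              ∎)
  where
  open ≡.≡-Reasoning
  p = suc (m ℕ.+ k) C k
  q = suc (m ℕ.+ k) C suc k
  split : ∀ m k p → suc (suc (m ℕ.+ k)) ℕ.* p ≡ suc k ℕ.* p ℕ.+ suc m ℕ.* p
  split = ℕSolver.solve-∀

-- The coefficient of t^n over a ring in which x is invertible.

module _ {c ℓ} (R : CommutativeRing c ℓ) where
  open CommutativeRing R

  module ChebyshevExpansion (x x⁻¹ : Carrier) (x*x⁻¹ : x * x⁻¹ ≈ 1#) where

    open PowerSeries R
    open SeriesRing R
    open RingProperties ring using (-1*x≈-x)
    open Mult semiring using (_×_; ×-congʳ; ×-congˡ; ×-homo-+; ×-assocˡ; ×-comm-*)
    open SemiringExp semiring using (_^_)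
    open SemiringSum semiring using (sum; sum-cong-≋)
    open SemiringSolver commutativeSemiring using (solve; _:=_; _:+_; con)
    private
      module ≈-R = SetoidReasoning setoid
      module S = CommutativeRing seriesRing
      module SM = Mult S.semiring
      module SS = SemiringSum S.semiring
    open Derivation seriesRing ∂ ∂-cong ∂-+ˢ ∂-*ˢ using (∂-inverse; ∂^; expansion; powerExpansion)

    [x-t] : Series
    [x-t] zero          = x
    [x-t] (suc zero)    = - 1#
    [x-t] (suc (suc _)) = 0#

    tail-[x-t]* : ∀ f → ([x-t] ∘ suc) *ˢ f ≋ S.- f
    tail-[x-t]* f zero    = trans (+-identityʳ _) (-1*x≈-x (f 0))
    tail-[x-t]* f (suc n) = trans (+-congʳ (zeroˡ _))
      (trans (+-identityˡ _) (tail-[x-t]* (f ∘ suc) n))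

    [x-t]*-suc : ∀ f n → ([x-t] *ˢ f) (suc n) ≈ x * f (suc n) - f n
    [x-t]*-suc f n = trans (*ˢ-suc [x-t] f n) (+-congˡ (tail-[x-t]* f n))

    Y : ℕ → Series
    Y m k = ((m ℕ.+ k) C k) × x⁻¹ ^ (suc m ℕ.+ k)

    x*x⁻¹^ : ∀ c n → x * (c × x⁻¹ ^ suc n) ≈ c × x⁻¹ ^ n
    x*x⁻¹^ c n = begin
      x * (c × x⁻¹ ^ suc n)      ≈⟨ ×-comm-* c _ _ ⟩
      c × (x * (x⁻¹ * x⁻¹ ^ n))  ≈⟨ ×-congʳ c (*-assoc _ _ _) ⟨
      c × (x * x⁻¹ * x⁻¹ ^ n)    ≈⟨ ×-congʳ c (trans (*-congʳ x*x⁻¹) (*-identityˡ _)) ⟩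
      c × x⁻¹ ^ n                ∎
      where open ≈-R

    x+y-x≈y : ∀ a b → a + b - a ≈ b
    x+y-x≈y a b = begin
      a + b - a      ≈⟨ +-congʳ (+-comm a b) ⟩
      b + a - a      ≈⟨ +-assoc b a (- a) ⟩
      b + (a - a)    ≈⟨ +-congˡ (-‿inverseʳ a) ⟩
      b + 0#         ≈⟨ +-identityʳ b ⟩
      b              ∎
      where open ≈-R

    [x-t]*Y₀ : [x-t] *ˢ Y 0 ≋ 1ˢ
    [x-t]*Y₀ zero = begin
      ([x-t] *ˢ Y 0) 0  ≈⟨ *ˢ-zero [x-t] (Y 0) ⟩
      x * Y 0 0         ≈⟨ x*x⁻¹^ 1 0 ⟩
      1 × 1#            ≈⟨ +-identityʳ 1# ⟩
      1#                ∎
      where open ≈-R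
    [x-t]*Y₀ (suc n) = begin
      ([x-t] *ˢ Y 0) (suc n)                                 ≈⟨ [x-t]*-suc (Y 0) n ⟩
      x * Y 0 (suc n) - Y 0 n                                ≈⟨ +-congʳ (x*x⁻¹^ (suc n C suc n) (suc n)) ⟩
      (suc n C suc n) × x⁻¹ ^ suc n - (n C n) × x⁻¹ ^ suc n  ≈⟨ +-congʳ (×-congˡ (≡.trans (nCn≡1 (suc n)) (≡.sym (nCn≡1 n)))) ⟩
      Y 0 n - Y 0 n                                          ≈⟨ -‿inverseʳ _ ⟩
      0#                                                     ∎
      where open ≈-R

    -- Pascal's rule in each coefficient: multiplication by x lowers the power of `x⁻¹` by one, and
    -- of the two binomials that make up the leading one, the part `p` cancels against the
    -- contribution of -t.
    [x-t]*Y : ∀ m → [x-t] *ˢ Y (suc m) ≋ Y m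
    [x-t]*Y m zero    = trans (*ˢ-zero [x-t] (Y (suc m))) (x*x⁻¹^ 1 (suc m ℕ.+ 0))
    [x-t]*Y m (suc n) = begin
      ([x-t] *ˢ Y (suc m)) (suc n)
        ≈⟨ [x-t]*-suc (Y (suc m)) n ⟩
      x * Y (suc m) (suc n) - Y (suc m) n
        ≈⟨ +-congʳ (x*x⁻¹^ ((suc m ℕ.+ suc n) C suc n) (suc m ℕ.+ suc n)) ⟩
      ((suc m ℕ.+ suc n) C suc n) × z - ((suc m ℕ.+ n) C n) × x⁻¹ ^ (suc (suc m) ℕ.+ n)
        ≡⟨ ≡.cong₂ (λ i j → i × z - ((suc m ℕ.+ n) C n) × x⁻¹ ^ j)
             (≡.sym pascal) (≡.sym (ℕₚ.+-suc (suc m) n)) ⟩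
      (p ℕ.+ q) × z - p × z
        ≈⟨ +-congʳ (×-homo-+ z p q) ⟩
      p × z + q × z - p × z
        ≈⟨ x+y-x≈y (p × z) (q × z) ⟩
      q × z ∎
      where
      open ≈-R
      z = x⁻¹ ^ (suc m ℕ.+ suc n)
      p = (suc m ℕ.+ n) C n
      q = (m ℕ.+ suc n) C suc n
      pascal : p ℕ.+ q ≡ (suc m ℕ.+ suc n) C suc n
      pascal = ≡.trans (≡.cong (λ i → (i C n) ℕ.+ q) (≡.sym (ℕₚ.+-suc m n)))
        (nCk+nC[k+1]≡[n+1]C[k+1] (m ℕ.+ suc n) n)

    sucS×-coeff : ∀ n f k → (n SM.× f) k ≈ n × f k
    sucS×-coeff zero    f k = refl
    sucS×-coeff (suc n) f k = +-congˡ (sucS×-coeff n f k)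

    ∂Y : ∀ m → ∂ (Y m) ≋ suc m SM.× Y (suc m)
    ∂Y m k = begin
      suc k × (((m ℕ.+ suc k) C suc k) × x⁻¹ ^ (suc m ℕ.+ suc k))
        ≈⟨ ×-assocˡ _ (suc k) ((m ℕ.+ suc k) C suc k) ⟩
      (suc k ℕ.* ((m ℕ.+ suc k) C suc k)) × x⁻¹ ^ (suc m ℕ.+ suc k)
        ≡⟨ ≡.cong (λ i → (suc k ℕ.* (i C suc k)) × x⁻¹ ^ suc i) (ℕₚ.+-suc m k) ⟩
      (suc k ℕ.* (suc (m ℕ.+ k) C suc k)) × x⁻¹ ^ (suc (suc m) ℕ.+ k)
        ≡⟨ ≡.cong (_× (x⁻¹ ^ (suc (suc m) ℕ.+ k))) ([k+1]*[1+m+k]C[k+1]≡[m+1]*[1+m+k]Ck m k) ⟩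
      (suc m ℕ.* (suc (m ℕ.+ k) C k)) × x⁻¹ ^ (suc (suc m) ℕ.+ k)
        ≈⟨ ×-assocˡ _ (suc m) (suc (m ℕ.+ k) C k) ⟨
      suc m × Y (suc m) k
        ≈⟨ sucS×-coeff (suc m) (Y (suc m)) k ⟨
      (suc m SM.× Y (suc m)) k ∎
      where open ≈-R

    ∂^-coeff : ∀ i f l → ∂^ i f l ≈ ((l ℕ.+ i) P′ i) × f (l ℕ.+ i)
    ∂^-coeff zero    f l = trans (reflexive (≡.cong f (≡.sym (ℕₚ.+-identityʳ l)))) (sym (+-identityʳ _))
    ∂^-coeff (suc i) f l = begin
      suc l × ∂^ i f (suc l)
        ≈⟨ ×-congʳ (suc l) (∂^-coeff i f (suc l)) ⟩
      suc l × ((suc (l ℕ.+ i) P′ i) × f (suc (l ℕ.+ i)))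
        ≈⟨ ×-assocˡ (f (suc (l ℕ.+ i))) (suc l) (suc (l ℕ.+ i) P′ i) ⟩
      (suc l ℕ.* (suc (l ℕ.+ i) P′ i)) × f (suc (l ℕ.+ i))
        -- The new factor l + 1 is the next factor of the falling factorial, as (l + 1 + i) - i = l
        -- + 1; `_P′_` multiplies its last factor on the left.
        ≡⟨ ≡.cong (λ k → (k ℕ.* (suc (l ℕ.+ i) P′ i)) × f (suc (l ℕ.+ i))) (ℕₚ.m+n∸n≡m (suc l) i) ⟨
      (suc (l ℕ.+ i) P′ suc i) × f (suc (l ℕ.+ i))
        ≡⟨ ≡.cong (λ k → (k P′ suc i) × f k) (ℕₚ.+-suc l i) ⟨
      ((l ℕ.+ suc i) P′ suc i) × f (l ℕ.+ suc i) ∎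
      where open ≈-R

    sumS-coeff : ∀ n (f : _ → Series) k → SS.sum {n} f k ≈ sum {n} (λ j → f j k)
    sumS-coeff zero    f k = refl
    sumS-coeff (suc n) f k = +-congˡ (sumS-coeff n (f ∘ suc) k)

    module _ (D F : Series) (D₁ : D 1 ≈ - (x + x)) (D₂ : D 2 ≈ 1#)
      (D₃ : ∀ n → D (suc (suc (suc n))) ≈ 0#) (D*F : D *ˢ F ≋ 1ˢ) where

      private
        cancel : ∀ {a b} → a ≈ - b → a + b ≈ 0#
        cancel {b = b} e = trans (+-congʳ e) (-‿inverseˡ b)

      ∂D+2[x-t]≈0 : ∂ D +ˢ ([x-t] +ˢ [x-t]) ≋ 0ˢ
      ∂D+2[x-t]≈0 zero = cancel (trans (+-identityʳ _) D₁)
      ∂D+2[x-t]≈0 (suc zero) = begin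
        2 × D 2 + (- 1# + - 1#)      ≈⟨ +-congʳ (×-congʳ 2 D₂) ⟩
        2 × 1# + (- 1# + - 1#)       ≈⟨ solve 1 (λ m → (con 1 :+ (con 1 :+ con 0)) :+ (m :+ m)
                                          := (con 1 :+ m) :+ (con 1 :+ m)) refl (- 1#) ⟩
        (1# + - 1#) + (1# + - 1#)    ≈⟨ +-cong (-‿inverseʳ 1#) (-‿inverseʳ 1#) ⟩
        0# + 0#                      ≈⟨ +-identityˡ 0# ⟩
        0#                           ∎
        where open ≈-R
      ∂D+2[x-t]≈0 (suc (suc n)) = begin
        (3 ℕ.+ n) × D (3 ℕ.+ n) + (0# + 0#)  ≈⟨ +-cong (×-congʳ (3 ℕ.+ n) (D₃ n)) (+-identityˡ 0#) ⟩
        (3 ℕ.+ n) × 0# + 0#                  ≈⟨ +-identityʳ _ ⟩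
        (3 ℕ.+ n) × 0#                       ≈⟨ ×-congʳ (3 ℕ.+ n) (zeroˡ 0#) ⟨
        (3 ℕ.+ n) × (0# * 0#)                ≈⟨ ×-comm-* (3 ℕ.+ n) 0# 0# ⟨
        0# * ((3 ℕ.+ n) × 0#)                ≈⟨ zeroˡ _ ⟩
        0#                                   ∎
        where open ≈-R

      ∂F : ∂ F ≋ 2 SM.× ([x-t] *ˢ (F *ˢ F))
      ∂F = ∂-inverse [x-t] D F D*F ∂D+2[x-t]≈0

      convolutionTerm : ℕ → ℕ → ℕ → ℕ → Carrier
      convolutionTerm N n j l =
        Y (2 ℕ.* N ∸ j) (n ∸ l) * ((l ℕ.+ suc j) P′ suc j) × F (l ℕ.+ suc j)

      coefficientExpansion : ∀ N n →
        normaliser (suc N) × (F ^ˢ suc (suc N)) n ≈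
        sum {suc N} (λ j → β N (toℕ j) × sum {suc n} (λ l → convolutionTerm N n (toℕ j) (toℕ l)))
      coefficientExpansion N n = begin
        normaliser (suc N) × (F ^ˢ suc (suc N)) n
          ≈⟨ sucS×-coeff (normaliser (suc N)) (F ^ˢ suc (suc N)) n ⟨
        (normaliser (suc N) SM.× F ^ˢ suc (suc N)) n
          ≈⟨ powerExpansion [x-t] F Y ∂F [x-t]*Y₀ [x-t]*Y ∂Y N n ⟩
        expansion [x-t] F Y ∂F [x-t]*Y₀ [x-t]*Y ∂Y N n
          ≈⟨ sumS-coeff (suc N) (λ j → β N (toℕ j) SM.× (Y (2 ℕ.* N ∸ toℕ j) *ˢ ∂^ (suc (toℕ j)) F)) n ⟩
        sum {suc N} (λ j → (β N (toℕ j) SM.× (Y (2 ℕ.* N ∸ toℕ j) *ˢ ∂^ (suc (toℕ j)) F)) n)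
          ≈⟨ sum-cong-≋ {suc N} (λ j → trans
               (sucS×-coeff (β N (toℕ j)) (Y (2 ℕ.* N ∸ toℕ j) *ˢ ∂^ (suc (toℕ j)) F) n)
               (×-congʳ (β N (toℕ j)) (sum-cong-≋ {suc n} λ l →
                 *-congˡ {Y (2 ℕ.* N ∸ toℕ j) (n ∸ toℕ l)} (∂^-coeff (suc (toℕ j)) F (toℕ l))))) ⟩
        sum {suc N} (λ j → β N (toℕ j) × sum {suc n} (λ l → convolutionTerm N n (toℕ j) (toℕ l))) ∎
        where open ≈-R

-- The nested sums a_i(N) satisfy the recurrence of `β`.

module Coefficients where
  open import Data.Rational.Base using (_+_; _*_; _-_; -_)
  open ℚᵘ using (mkℚᵘ; *≡*)
  open ℚSolver.+-*-Solver using (solve; _:=_; _:+_; _:*_; _:-_; con)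
  open ≡
  private
    module ℕSum = MonoidSum ℕₚ.+-0-monoid
    module ℚSum = SemiringSum (CommutativeRing.semiring ℚₚ.+-*-commutativeRing)
    module ℚProd = MonoidSum ℚₚ.*-1-monoid

  -- Rationals are kept in lowest terms, so the equation is checked by cross-multiplying
  -- unnormalised representatives.
  /-homo-+ : ∀ i j d → (i ℤ.+ j) ℚ./ suc d ≡ i ℚ./ suc d + j ℚ./ suc d
  /-homo-+ i j d = ℚₚ.toℚᵘ-injective (begin
    ℚ.toℚᵘ ((i ℤ.+ j) ℚ./ suc d)                  ≈⟨ ℚₚ.toℚᵘ-fromℚᵘ (mkℚᵘ (i ℤ.+ j) d) ⟩
    mkℚᵘ (i ℤ.+ j) d                              ≈⟨ *≡* (lemma i j (+ suc d)) ⟩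
    mkℚᵘ i d ℚᵘ.+ mkℚᵘ j d                        ≈⟨ ℚᵘₚ.+-cong (ℚₚ.toℚᵘ-fromℚᵘ (mkℚᵘ i d)) (ℚₚ.toℚᵘ-fromℚᵘ (mkℚᵘ j d)) ⟨
    ℚ.toℚᵘ (i ℚ./ suc d) ℚᵘ.+ ℚ.toℚᵘ (j ℚ./ suc d) ≈⟨ ℚₚ.toℚᵘ-homo-+ (i ℚ./ suc d) (j ℚ./ suc d) ⟨
    ℚ.toℚᵘ (i ℚ./ suc d + j ℚ./ suc d)            ∎)
    where
    open ℚᵘₚ.≃-Reasoning
    lemma : ∀ i j e → (i ℤ.+ j) ℤ.* (e ℤ.* e) ≡ (i ℤ.* e ℤ.+ j ℤ.* e) ℤ.* e
    lemma = ℤSolver.solve-∀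

  fromℕ-+ : ∀ m n → fromℕ (m ℕ.+ n) ≡ fromℕ m + fromℕ n
  fromℕ-+ m n = /-homo-+ (+ m) (+ n) 0

  fromℕ-* : ∀ m n → fromℕ (m ℕ.* n) ≡ fromℕ m * fromℕ n
  fromℕ-* zero    n = sym (ℚₚ.*-zeroˡ (fromℕ n))
  fromℕ-* (suc m) n = begin
    fromℕ (n ℕ.+ m ℕ.* n)              ≡⟨ fromℕ-+ n (m ℕ.* n) ⟩
    fromℕ n + fromℕ (m ℕ.* n)          ≡⟨ cong (λ k → fromℕ n + k) (fromℕ-* m n) ⟩
    fromℕ n + fromℕ m * fromℕ n        ≡⟨ solve 2 (λ m n → n :+ m :* n := (con 1ℚ :+ m) :* n) refl (fromℕ m) (fromℕ n) ⟩
    (1ℚ + fromℕ m) * fromℕ n           ≡⟨ cong (_* fromℕ n) (fromℕ-+ 1 m) ⟨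
    fromℕ (suc m) * fromℕ n            ∎
    where open ≡-Reasoning

  fromℕ-∸ : ∀ {m n} → n ≤ m → fromℕ (m ∸ n) ≡ fromℕ m - fromℕ n
  fromℕ-∸ {m} {n} n≤m = begin
    fromℕ (m ∸ n)                        ≡⟨ solve 2 (λ a b → a := (b :+ a) :- b) refl (fromℕ (m ∸ n)) (fromℕ n) ⟩
    (fromℕ n + fromℕ (m ∸ n)) - fromℕ n  ≡⟨ cong (_- fromℕ n) (fromℕ-+ n (m ∸ n)) ⟨
    fromℕ (n ℕ.+ (m ∸ n)) - fromℕ n      ≡⟨ cong (λ k → fromℕ k - fromℕ n) (ℕₚ.m+[n∸m]≡n n≤m) ⟩
    fromℕ m - fromℕ n                    ∎
    where open ≡-Reasoning

  falling-fromℕ : ∀ n k → k ≤ n → falling (fromℕ n) k ≡ fromℕ (n P′ k)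
  falling-fromℕ n zero    _   = refl
  falling-fromℕ n (suc k) k<n = begin
    falling (fromℕ n) k * (fromℕ n - fromℕ k)  ≡⟨ cong₂ _*_ (falling-fromℕ n k (ℕₚ.<⇒≤ k<n)) (sym (fromℕ-∸ (ℕₚ.<⇒≤ k<n))) ⟩
    fromℕ (n P′ k) * fromℕ (n ∸ k)             ≡⟨ ℚₚ.*-comm (fromℕ (n P′ k)) (fromℕ (n ∸ k)) ⟩
    fromℕ (n ∸ k) * fromℕ (n P′ k)             ≡⟨ fromℕ-* (n ∸ k) (n P′ k) ⟨
    fromℕ ((n ∸ k) ℕ.* (n P′ k))               ∎
    where open ≡-Reasoning

  -- `falling` is defined by splitting off its last factor. Raising N by one shifts the argument y
  -- by one, and for that the first factor has to be split off instead.
  falling-suc : ∀ y k → falling y (suc k) ≡ y * falling (y - 1ℚ) k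
  falling-suc y zero    = solve 1 (λ y → con 1ℚ :* (y :- con 0ℚ) := y :* con 1ℚ) refl y
  falling-suc y (suc k) = begin
    falling y (suc k) * (y - fromℕ (suc k))
      ≡⟨ cong₂ (λ a b → a * (y - b)) (falling-suc y k) (fromℕ-+ 1 k) ⟩
    y * falling (y - 1ℚ) k * (y - (1ℚ + fromℕ k))
      ≡⟨ solve 3 (λ y f k → y :* f :* (y :- (con 1ℚ :+ k)) := y :* (f :* ((y :- con 1ℚ) :- k)))
           refl y (falling (y - 1ℚ) k) (fromℕ k) ⟩
    y * (falling (y - 1ℚ) k * (y - 1ℚ - fromℕ k)) ∎
    where open ≡-Reasoning

  half : ℕ → ℚ
  half n = + n ℚ./ 2

  half+half : ∀ n → half n + half n ≡ fromℕ n
  half+half n = trans (sym (/-homo-+ (+ n) (+ n) 1)) (ℚₚ.toℚᵘ-injective (begin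
    ℚ.toℚᵘ ((+ n ℤ.+ + n) ℚ./ 2)  ≈⟨ ℚₚ.toℚᵘ-fromℚᵘ (mkℚᵘ (+ n ℤ.+ + n) 1) ⟩
    mkℚᵘ (+ n ℤ.+ + n) 1          ≈⟨ *≡* (lemma (+ n)) ⟩
    mkℚᵘ (+ n) 0                  ≈⟨ ℚₚ.toℚᵘ-fromℚᵘ (mkℚᵘ (+ n) 0) ⟨
    ℚ.toℚᵘ (fromℕ n)              ∎))
    where
    open ℚᵘₚ.≃-Reasoning
    lemma : ∀ i → (i ℤ.+ i) ℤ.* + 1 ≡ i ℤ.* + 2
    lemma = ℤSolver.solve-∀

  ≔-updated : ∀ k m c → (k [ m ≔ c ]) m ≡ c
  ≔-updated k m c = cong (if_then c else k m) (≡ᵇ-refl m)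
    where
    ≡ᵇ-refl : ∀ m → (m ≡ᵇ m) ≡ true
    ≡ᵇ-refl zero    = refl
    ≡ᵇ-refl (suc m) = ≡ᵇ-refl m

  ≔-below : ∀ k {m l} c → l < m → (k [ m ≔ c ]) l ≡ k l
  ≔-below k {m} {l} c l<m = cong (if_then c else k l) (<⇒≢ᵇ l<m)
    where
    <⇒≢ᵇ : ∀ {l m} → l < m → (l ≡ᵇ m) ≡ false
    <⇒≢ᵇ {zero}  (s≤s _)   = refl
    <⇒≢ᵇ {suc l} (s≤s l<m) = <⇒≢ᵇ l<m

  partialSum-empty : ∀ k lo → partialSum k (suc lo) lo ≡ 0
  partialSum-empty k lo = empty (ℕₚ.n∸n≡0 lo)
    where
    empty : ∀ {r} → r ≡ 0 → ℕSum.sum {r} (λ t → k (suc lo ℕ.+ toℕ t)) ≡ 0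
    empty refl = refl

  partialSum-≔ : ∀ k {m j} c → j ≤ m →
    partialSum (k [ suc m ≔ c ]) (suc j) (suc m) ≡ partialSum k (suc j) m ℕ.+ c
  partialSum-≔ k {m} {j} c j≤m = begin
    ℕSum.sum {suc m ∸ j} (λ t → k′ (suc j ℕ.+ toℕ t))
      ≡⟨ cong (λ r → ℕSum.sum {r} (λ t → k′ (suc j ℕ.+ toℕ t))) (ℕₚ.+-∸-assoc 1 j≤m) ⟩
    ℕSum.sum {suc (m ∸ j)} (λ t → k′ (suc j ℕ.+ toℕ t))
      ≡⟨ sum-last ℕₚ.+-0-monoid (m ∸ j) (λ t → k′ (suc j ℕ.+ t)) ⟩
    ℕSum.sum {m ∸ j} (λ t → k′ (suc j ℕ.+ toℕ t)) ℕ.+ k′ (suc j ℕ.+ (m ∸ j))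
      ≡⟨ cong₂ ℕ._+_
           (ℕSum.sum-cong-≗ {m ∸ j} (λ t → ≔-below k c (s≤s (below (toℕ<n t)))))
           (trans (cong (λ l → k′ (suc l)) (ℕₚ.m+[n∸m]≡n j≤m)) (≔-updated k (suc m) c)) ⟩
    partialSum k (suc j) m ℕ.+ c ∎
    where
    open ≡-Reasoning
    k′ = k [ suc m ≔ c ]
    below : ∀ {t} → t < m ∸ j → j ℕ.+ t < m
    below t<m∸j = subst (j ℕ.+ _ <_) (ℕₚ.m+[n∸m]≡n j≤m) (ℕₚ.+-monoʳ-< j t<m∸j)

  nestedSum-cong : ∀ m M {f g} → (∀ k → f k ≡ g k) → nestedSum m M f ≡ nestedSum m M g
  nestedSum-cong zero    M e = e _
  nestedSum-cong (suc m) M e = ℚSum.sum-cong-≗ {suc M} λ c →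
    nestedSum-cong m (M ∸ toℕ c) (λ k → e (k [ suc m ≔ toℕ c ]))

  nestedSum-* : ∀ m M s f → nestedSum m M (λ k → s * f k) ≡ s * nestedSum m M f
  nestedSum-* zero    M s f = refl
  nestedSum-* (suc m) M s f = trans
    (ℚSum.sum-cong-≗ {suc M} λ c → nestedSum-* m (M ∸ toℕ c) s (λ k → f (k [ suc m ≔ toℕ c ])))
    (sym (ℚSum.*-distribˡ-sum {suc M} s
      (λ c → nestedSum m (M ∸ toℕ c) (λ k → f (k [ suc m ≔ toℕ c ])))))

  argument : (i N : ℕ) → (ℕ → ℕ) → ℕ → ℚ
  argument i N k j =
    fromℕ N - fromℕ (partialSum k j (i ∸ 1)) - (+ (2 ℕ.* i ℕ.+ 2) ℤ.- + j) ℚ./ 2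

  -- The product over j from 2 unfolds to an index t from 0 with j = 2 + t, whence k_{j-1} is
  -- `k (suc t)`.
  factor : (i N : ℕ) → (ℕ → ℕ) → ℕ → ℚ
  factor i N k t = falling (argument i N k (2 ℕ.+ t)) (k (suc t))

  -- The argument of the last falling factorial, the one with j = i = m + 2.
  top : ℕ → ℕ → ℚ
  top m N = fromℕ N - half (4 ℕ.+ m)

  argument-top : ∀ m N k → argument (2 ℕ.+ m) N k (2 ℕ.+ m) ≡ top m N
  argument-top m N k = begin
    fromℕ N - fromℕ (partialSum k (2 ℕ.+ m) (suc m)) - (+ (2 ℕ.* (2 ℕ.+ m) ℕ.+ 2) ℤ.- + (2 ℕ.+ m)) ℚ./ 2
      ≡⟨ cong₂ (λ p i → fromℕ N - fromℕ p - i ℚ./ 2) (partialSum-empty k (suc m)) numerator ⟩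
    fromℕ N - 0ℚ - half (4 ℕ.+ m)
      ≡⟨ solve 2 (λ n h → (n :- con 0ℚ) :- h := n :- h) refl (fromℕ N) (half (4 ℕ.+ m)) ⟩
    top m N ∎
    where
    open ≡-Reasoning
    lemma : ∀ m → 2 ℕ.* (2 ℕ.+ m) ℕ.+ 2 ≡ (4 ℕ.+ m) ℕ.+ (2 ℕ.+ m)
    lemma = ℕSolver.solve-∀
    cancel : ∀ a b → a ℤ.+ b ℤ.- b ≡ a
    cancel = ℤSolver.solve-∀
    numerator : + (2 ℕ.* (2 ℕ.+ m) ℕ.+ 2) ℤ.- + (2 ℕ.+ m) ≡ + (4 ℕ.+ m)
    numerator = trans (cong (λ n → + n ℤ.- + (2 ℕ.+ m)) (lemma m))
      (cancel (+ (4 ℕ.+ m)) (+ (2 ℕ.+ m)))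

  -- Lowering i by one lowers (2i+2-j)/2 by one, and fixing the outermost variable takes c out of
  -- the partial sum. Both effects are absorbed by replacing N with N - 1 - c.
  argument-≔ : ∀ k {m N t} c → suc c ≤ N → t < m →
    argument (2 ℕ.+ m) N (k [ suc m ≔ c ]) (2 ℕ.+ t) ≡ argument (suc m) (N ∸ suc c) k (2 ℕ.+ t)
  argument-≔ k {m} {N} {t} c c<N t<m = begin
    fromℕ N - fromℕ (partialSum (k [ suc m ≔ c ]) (2 ℕ.+ t) (suc m)) - i′ ℚ./ 2
      ≡⟨ cong₂ (λ p h → fromℕ N - fromℕ p - h) (partialSum-≔ k c t<m) halves ⟩
    fromℕ N - fromℕ (p ℕ.+ c) - (1ℚ + i ℚ./ 2)
      ≡⟨ cong (λ p → fromℕ N - p - (1ℚ + i ℚ./ 2)) (fromℕ-+ p c) ⟩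
    fromℕ N - (fromℕ p + fromℕ c) - (1ℚ + i ℚ./ 2)
      ≡⟨ solve 4 (λ n p c h → (n :- (p :+ c)) :- (con 1ℚ :+ h) := ((n :- (con 1ℚ :+ c)) :- p) :- h)
           refl (fromℕ N) (fromℕ p) (fromℕ c) (i ℚ./ 2) ⟩
    fromℕ N - (1ℚ + fromℕ c) - fromℕ p - i ℚ./ 2
      ≡⟨ cong (λ q → q - fromℕ p - i ℚ./ 2)
           (trans (cong (λ q → fromℕ N - q) (sym (fromℕ-+ 1 c))) (sym (fromℕ-∸ c<N))) ⟩
    fromℕ (N ∸ suc c) - fromℕ p - i ℚ./ 2 ∎
    where
    open ≡-Reasoning
    p = partialSum k (2 ℕ.+ t) m
    i i′ : ℤ.ℤ
    i  = + (2 ℕ.* suc m ℕ.+ 2) ℤ.- + (2 ℕ.+ t)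
    i′ = + (2 ℕ.* (2 ℕ.+ m) ℕ.+ 2) ℤ.- + (2 ℕ.+ t)
    lemma : ∀ m → 2 ℕ.* (2 ℕ.+ m) ℕ.+ 2 ≡ 2 ℕ.+ (2 ℕ.* suc m ℕ.+ 2)
    lemma = ℕSolver.solve-∀
    halves : i′ ℚ./ 2 ≡ 1ℚ + i ℚ./ 2
    halves = trans
      (cong (ℚ._/ 2) (trans (cong (λ n → + n ℤ.- + (2 ℕ.+ t)) (lemma m))
        (ℤₚ.+-assoc (+ 2) (+ (2 ℕ.* suc m ℕ.+ 2)) (ℤ.- + (2 ℕ.+ t)))))
      (/-homo-+ (+ 2) i 1)

  -- The outermost variable c occurs on its own only in 2^c and in the falling factorial with j = i.
  -- Everything else, the double factorial included, depends on c only through N - 1 - c and forms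
  -- the summand of level i - 1.
  aSummand-≔ : ∀ k {m N} c → suc c ≤ N →
    aSummand (2 ℕ.+ m) N (k [ suc m ≔ c ]) ≡
    (fromℕ (2 ℕ.^ c) * falling (top m N) c) * aSummand (suc m) (N ∸ suc c) k
  aSummand-≔ k {m} {N} c c<N = begin
    fromℕ (2 ℕ.^ p′) * ℚProd.sum {suc m} (λ t → factor (2 ℕ.+ m) N k′ (toℕ t))
      * fromℕ [2 N ∸ (2 ℕ.+ m) ∸ p′ -1]!!
      ≡⟨ cong₂ _*_ (cong₂ _*_ power product) (cong (λ n → fromℕ [2 n -1]!!) index) ⟩
    (fromℕ (2 ℕ.^ p) * fromℕ (2 ℕ.^ c)) * (prod * falling (top m N) c)
      * fromℕ [2 N ∸ suc c ∸ suc m ∸ p -1]!!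
      ≡⟨ solve 5 (λ p c q f d → (p :* c) :* (q :* f) :* d := (c :* f) :* (p :* q :* d)) refl
           (fromℕ (2 ℕ.^ p)) (fromℕ (2 ℕ.^ c)) prod (falling (top m N) c)
           (fromℕ [2 N ∸ suc c ∸ suc m ∸ p -1]!!) ⟩
    (fromℕ (2 ℕ.^ c) * falling (top m N) c) * aSummand (suc m) (N ∸ suc c) k ∎
    where
    open ≡-Reasoning
    k′ = k [ suc m ≔ c ]
    p = partialSum k 1 m
    p′ = partialSum k′ 1 (suc m)
    prod = ℚProd.sum {m} (λ t → factor (suc m) (N ∸ suc c) k (toℕ t))
    p′≡p+c : p′ ≡ p ℕ.+ c
    p′≡p+c = partialSum-≔ k {m} {0} c z≤n
    power : fromℕ (2 ℕ.^ p′) ≡ fromℕ (2 ℕ.^ p) * fromℕ (2 ℕ.^ c)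
    power = trans (cong fromℕ (trans (cong (2 ℕ.^_) p′≡p+c) (ℕₚ.^-distribˡ-+-* 2 p c)))
      (fromℕ-* (2 ℕ.^ p) (2 ℕ.^ c))
    product : ℚProd.sum {suc m} (λ t → factor (2 ℕ.+ m) N k′ (toℕ t)) ≡ prod * falling (top m N) c
    product = trans (sum-last ℚₚ.*-1-monoid m (factor (2 ℕ.+ m) N k′)) (cong₂ _*_
      (ℚProd.sum-cong-≗ {m} λ t → cong₂ falling
        (argument-≔ k c c<N (toℕ<n t)) (≔-below k c (s≤s (toℕ<n t))))
      (cong₂ falling (argument-top m N k′) (≔-updated k (suc m) c)))
    lemma : ∀ m p c → 2 ℕ.+ m ℕ.+ (p ℕ.+ c) ≡ suc c ℕ.+ suc m ℕ.+ p
    lemma = ℕSolver.solve-∀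
    index : N ∸ (2 ℕ.+ m) ∸ p′ ≡ N ∸ suc c ∸ suc m ∸ p
    index = begin
      N ∸ (2 ℕ.+ m) ∸ p′             ≡⟨ cong (N ∸ (2 ℕ.+ m) ∸_) p′≡p+c ⟩
      N ∸ (2 ℕ.+ m) ∸ (p ℕ.+ c)      ≡⟨ ℕₚ.∸-+-assoc N (2 ℕ.+ m) (p ℕ.+ c) ⟩
      N ∸ (2 ℕ.+ m ℕ.+ (p ℕ.+ c))    ≡⟨ cong (N ∸_) (lemma m p c) ⟩
      N ∸ (suc c ℕ.+ suc m ℕ.+ p)    ≡⟨ ℕₚ.∸-+-assoc N (suc c ℕ.+ suc m) p ⟨
      N ∸ (suc c ℕ.+ suc m) ∸ p      ≡⟨ cong (_∸ p) (ℕₚ.∸-+-assoc N (suc c) (suc m)) ⟨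
      N ∸ suc c ∸ suc m ∸ p          ∎

  -- a (suc m) N, with the case i = 1 as an instance of the general one.
  A : ℕ → ℕ → ℚ
  A m N = nestedSum m (N ∸ suc m) (aSummand (suc m) N)

  A-zero : ∀ N → A 0 N ≡ fromℕ [2 N ∸ 1 -1]!!
  A-zero N = solve 1 (λ d → con 1ℚ :* con 1ℚ :* d := d) refl (fromℕ [2 N ∸ 1 -1]!!)

  A-correct : ∀ m N → a (suc m) N ≡ A m N
  A-correct zero    N = sym (A-zero N)
  A-correct (suc m) N = refl

  weighted : ℕ → ℕ → ℕ → ℚ
  weighted m N c = (fromℕ (2 ℕ.^ c) * falling (top m N) c) * A m (N ∸ suc c)

  -- Writing N as r + i encodes i ≤ N and makes r the upper limit of the outermost sum.
  A-suc : ∀ m r → let N = r ℕ.+ (2 ℕ.+ m) in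
    A (suc m) N ≡ ℚSum.sum {suc r} (λ c → weighted m N (toℕ c))
  A-suc m r = begin
    A (suc m) N
      ≡⟨ cong (λ M → nestedSum (suc m) M (aSummand (2 ℕ.+ m) N)) (ℕₚ.m+n∸n≡m r (2 ℕ.+ m)) ⟩
    ℚSum.sum {suc r} (λ c → nestedSum m (r ∸ toℕ c) (λ k → aSummand (2 ℕ.+ m) N (k [ suc m ≔ toℕ c ])))
      ≡⟨ ℚSum.sum-cong-≗ {suc r} (λ c → inner (toℕ c) (toℕ≤pred[n] c)) ⟩
    ℚSum.sum {suc r} (λ c → weighted m N (toℕ c)) ∎
    where
    open ≡-Reasoning
    N = r ℕ.+ (2 ℕ.+ m)
    lemma : ∀ c m → 2 ℕ.+ m ℕ.+ c ≡ suc c ℕ.+ suc m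
    lemma = ℕSolver.solve-∀
    bound : ∀ c → r ∸ c ≡ N ∸ suc c ∸ suc m
    bound c = begin
      r ∸ c                      ≡⟨ cong (_∸ c) (ℕₚ.m+n∸n≡m r (2 ℕ.+ m)) ⟨
      N ∸ (2 ℕ.+ m) ∸ c          ≡⟨ ℕₚ.∸-+-assoc N (2 ℕ.+ m) c ⟩
      N ∸ (2 ℕ.+ m ℕ.+ c)        ≡⟨ cong (N ∸_) (lemma c m) ⟩
      N ∸ (suc c ℕ.+ suc m)      ≡⟨ ℕₚ.∸-+-assoc N (suc c) (suc m) ⟨
      N ∸ suc c ∸ suc m          ∎
    inner : ∀ c → c ≤ r →
      nestedSum m (r ∸ c) (λ k → aSummand (2 ℕ.+ m) N (k [ suc m ≔ c ])) ≡ weighted m N c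
    inner c c≤r = begin
      nestedSum m (r ∸ c) (λ k → aSummand (2 ℕ.+ m) N (k [ suc m ≔ c ]))
        ≡⟨ nestedSum-cong m (r ∸ c) (λ k → aSummand-≔ k {m} {N} c c<N) ⟩
      nestedSum m (r ∸ c) (λ k → (fromℕ (2 ℕ.^ c) * falling (top m N) c) * aSummand (suc m) (N ∸ suc c) k)
        ≡⟨ nestedSum-* m (r ∸ c) (fromℕ (2 ℕ.^ c) * falling (top m N) c) (aSummand (suc m) (N ∸ suc c)) ⟩
      (fromℕ (2 ℕ.^ c) * falling (top m N) c) * nestedSum m (r ∸ c) (aSummand (suc m) (N ∸ suc c))
        ≡⟨ cong (λ M → (fromℕ (2 ℕ.^ c) * falling (top m N) c) * nestedSum m M (aSummand (suc m) (N ∸ suc c))) (bound c) ⟩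
      weighted m N c ∎
      where
      c<N : suc c ≤ N
      c<N = ℕₚ.≤-trans (s≤s c≤r) (subst (suc r ≤_) (sym (ℕₚ.+-suc r (suc m))) (s≤s (ℕₚ.m≤m+n r (suc m))))

  weighted-zero : ∀ m N → weighted m (suc N) 0 ≡ A m N
  weighted-zero m N = solve 1 (λ z → con 1ℚ :* con 1ℚ :* z := z) refl (A m N)

  top-suc : ∀ m N → top m (suc N) ≡ 1ℚ + top m N
  top-suc m N = trans (cong (_- half (4 ℕ.+ m)) (fromℕ-+ 1 N)) (ℚₚ.+-assoc 1ℚ (fromℕ N) (- half (4 ℕ.+ m)))

  -- With y = `top m N`, (1+y)_{c+1} = (1+y)(y)_c, and the inner value of `A` is the same on both
  -- sides. The ratio of the two terms is thus independent of c and can be taken out of the sum.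
  weighted-suc : ∀ m N c →
    weighted m (suc N) (suc c) ≡ (fromℕ 2 * (1ℚ + top m N)) * weighted m N c
  weighted-suc m N c = begin
    (fromℕ (2 ℕ.* 2 ℕ.^ c) * falling (top m (suc N)) (suc c)) * A m (N ∸ suc c)
      ≡⟨ cong (_* A m (N ∸ suc c)) (cong₂ _*_ (fromℕ-* 2 (2 ℕ.^ c))
           (trans (cong (λ y → falling y (suc c)) (top-suc m N)) (falling-suc (1ℚ + top m N) c))) ⟩
    (fromℕ 2 * fromℕ (2 ℕ.^ c) * ((1ℚ + top m N) * falling (1ℚ + top m N - 1ℚ) c)) * A m (N ∸ suc c)
      ≡⟨ cong (λ y → (fromℕ 2 * fromℕ (2 ℕ.^ c) * ((1ℚ + top m N) * falling y c)) * A m (N ∸ suc c))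
           (solve 1 (λ y → (con 1ℚ :+ y) :- con 1ℚ := y) refl (top m N)) ⟩
    (fromℕ 2 * fromℕ (2 ℕ.^ c) * ((1ℚ + top m N) * falling (top m N) c)) * A m (N ∸ suc c)
      ≡⟨ solve 5 (λ t p y f z → t :* p :* (y :* f) :* z := t :* y :* (p :* f :* z)) refl
           (fromℕ 2) (fromℕ (2 ℕ.^ c)) (1ℚ + top m N) (falling (top m N) c) (A m (N ∸ suc c)) ⟩
    (fromℕ 2 * (1ℚ + top m N)) * weighted m N c ∎
    where open ≡-Reasoning

  -- The factor 2 clears the half-integer: 2(M + 2) - (4 + m) = 2M - m, which is the coefficient in
  -- the recurrence of `β`.
  top-fromℕ : ∀ m M → m ≤ 2 ℕ.* M → fromℕ 2 * (1ℚ + top m (suc M)) ≡ fromℕ (2 ℕ.* M ∸ m)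
  top-fromℕ m M m≤2M = begin
    fromℕ 2 * (1ℚ + (fromℕ (suc M) - h))
      ≡⟨ cong (λ n → fromℕ 2 * (1ℚ + (n - h))) (fromℕ-+ 1 M) ⟩
    fromℕ 2 * (1ℚ + (1ℚ + fromℕ M - h))
      ≡⟨ solve 2 (λ n h → con (fromℕ 2) :* (con 1ℚ :+ ((con 1ℚ :+ n) :- h))
           := (con (fromℕ 4) :+ con (fromℕ 2) :* n) :- (h :+ h)) refl (fromℕ M) h ⟩
    fromℕ 4 + fromℕ 2 * fromℕ M - (h + h)
      ≡⟨ cong₂ (λ n d → fromℕ 4 + n - d) (sym (fromℕ-* 2 M)) (half+half (4 ℕ.+ m)) ⟩
    fromℕ 4 + fromℕ (2 ℕ.* M) - fromℕ (4 ℕ.+ m)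
      ≡⟨ cong (_- fromℕ (4 ℕ.+ m)) (fromℕ-+ 4 (2 ℕ.* M)) ⟨
    fromℕ (4 ℕ.+ 2 ℕ.* M) - fromℕ (4 ℕ.+ m)
      ≡⟨ fromℕ-∸ (ℕₚ.+-monoʳ-≤ 4 m≤2M) ⟨
    fromℕ (2 ℕ.* M ∸ m) ∎
    where
    open ≡-Reasoning
    h = half (4 ℕ.+ m)

  -- At N = i the outermost variable can only be 0, so a single term of the sum remains. The general
  -- recurrence does not reach this case, as it would refer to a_i(i-1).
  A-diagonal : ∀ m → A (suc m) (2 ℕ.+ m) ≡ A m (suc m)
  A-diagonal m = trans (A-suc m 0) (trans (ℚₚ.+-identityʳ _) (weighted-zero m (suc m)))

  A-recurrence : ∀ {m M} → m < M →
    A (suc m) (2 ℕ.+ M) ≡ fromℕ (2 ℕ.* M ∸ m) * A (suc m) (suc M) + A m (suc M)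
  A-recurrence {m} {M} m<M = subst
    (λ N → A (suc m) (suc N) ≡ fromℕ (2 ℕ.* M ∸ m) * A (suc m) N + A m N) N≡1+M (begin
      A (suc m) (suc N)
        ≡⟨ A-suc m (suc r) ⟩
      weighted m (suc N) 0 + ℚSum.sum {suc r} (λ c → weighted m (suc N) (suc (toℕ c)))
        ≡⟨ cong₂ _+_ (weighted-zero m N) (ℚSum.sum-cong-≗ {suc r} (λ c → weighted-suc m N (toℕ c))) ⟩
      A m N + ℚSum.sum {suc r} (λ c → s * weighted m N (toℕ c))
        ≡⟨ cong (λ z → A m N + z) (ℚSum.*-distribˡ-sum {suc r} s (λ c → weighted m N (toℕ c))) ⟨
      A m N + s * ℚSum.sum {suc r} (λ c → weighted m N (toℕ c))
        ≡⟨ cong₂ (λ t z → A m N + t * z) s≡ (sym (A-suc m r)) ⟩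
      A m N + fromℕ (2 ℕ.* M ∸ m) * A (suc m) N
        ≡⟨ ℚₚ.+-comm (A m N) _ ⟩
      fromℕ (2 ℕ.* M ∸ m) * A (suc m) N + A m N ∎)
    where
    open ≡-Reasoning
    -- Since m < M, N = M + 1 has the form r + (2 + m) required by `A-suc`. The two agree only up to
    -- a proved equation, hence the transport along `N≡1+M`.
    r = M ∸ suc m
    N = r ℕ.+ (2 ℕ.+ m)
    s = fromℕ 2 * (1ℚ + top m N)
    N≡1+M : N ≡ suc M
    N≡1+M = trans (ℕₚ.+-suc r (suc m)) (cong suc (ℕₚ.m∸n+n≡m m<M))
    s≡ : s ≡ fromℕ (2 ℕ.* M ∸ m)
    s≡ = trans (cong (λ N → fromℕ 2 * (1ℚ + top m N)) N≡1+M)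
      (top-fromℕ m M (ℕₚ.≤-trans (ℕₚ.<⇒≤ m<M) (ℕₚ.m≤m+n M _)))

  -- The values on the left edge, the rule on the diagonal and the recurrence inside reach every
  -- entry of the triangle j ≤ M.
  β-unique : (B : ℕ → ℕ → ℚ) →
    (∀ N → B 0 N ≡ fromℕ [2 N ∸ 1 -1]!!) →
    (∀ m → B (suc m) (2 ℕ.+ m) ≡ B m (suc m)) →
    (∀ {m M} → m < M → B (suc m) (2 ℕ.+ M) ≡ fromℕ (2 ℕ.* M ∸ m) * B (suc m) (suc M) + B m (suc M)) →
    ∀ {M j} → j ≤ M → B j (suc M) ≡ fromℕ (β M j)
  β-unique B B-zero B-diagonal B-recurrence = go
    where
    lemma : ∀ M → suc M ℕ.+ 1 ℕ.* suc M ≡ suc (suc (2 ℕ.* M))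
    lemma = ℕSolver.solve-∀
    β-zero : ∀ M → [2 M -1]!! ≡ β M 0
    β-zero zero    = refl
    β-zero (suc M) = cong₂ ℕ._*_ (cong (_∸ 1) (lemma M)) (β-zero M)
    go : ∀ {M j} → j ≤ M → B j (suc M) ≡ fromℕ (β M j)
    go {M} {zero} _ = trans (B-zero (suc M)) (cong fromℕ (β-zero M))
    go {suc M} {suc m} (s≤s m≤M) with ℕₚ.m≤n⇒m<n∨m≡n m≤M
    ... | inj₁ m<M = begin
      B (suc m) (2 ℕ.+ M)
        ≡⟨ B-recurrence m<M ⟩
      fromℕ (2 ℕ.* M ∸ m) * B (suc m) (suc M) + B m (suc M)
        ≡⟨ cong₂ (λ u v → fromℕ (2 ℕ.* M ∸ m) * u + v) (go m<M) (go m≤M) ⟩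
      fromℕ (2 ℕ.* M ∸ m) * fromℕ (β M (suc m)) + fromℕ (β M m)
        ≡⟨ cong (_+ fromℕ (β M m)) (fromℕ-* (2 ℕ.* M ∸ m) (β M (suc m))) ⟨
      fromℕ ((2 ℕ.* M ∸ m) ℕ.* β M (suc m)) + fromℕ (β M m)
        ≡⟨ fromℕ-+ ((2 ℕ.* M ∸ m) ℕ.* β M (suc m)) (β M m) ⟨
      fromℕ (β (suc M) (suc m)) ∎
      where open ≡-Reasoning
    ... | inj₂ refl = begin
      B (suc m) (2 ℕ.+ m)        ≡⟨ B-diagonal m ⟩
      B m (suc m)                ≡⟨ go {m} {m} ℕₚ.≤-refl ⟩
      -- On the diagonal the recurrence of `β` collapses to its second summand, because β m (m+1) =
      -- 0.
      fromℕ (β m m)              ≡⟨ cong (λ b → fromℕ (b ℕ.+ β m m)) (ℕₚ.*-zeroʳ (2 ℕ.* m ∸ m)) ⟨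
      fromℕ ((2 ℕ.* m ∸ m) ℕ.* 0 ℕ.+ β m m)
        ≡⟨ cong (λ b → fromℕ ((2 ℕ.* m ∸ m) ℕ.* b ℕ.+ β m m)) (β-vanishes {m} ℕₚ.≤-refl) ⟨
      fromℕ (β (suc m) (suc m))  ∎
      where open ≡-Reasoning

  a-β : ∀ {M j} → j ≤ M → a (suc j) (suc M) ≡ fromℕ (β M j)
  a-β {M} {j} j≤M = trans (A-correct j (suc M))
    (β-unique A A-zero A-diagonal A-recurrence j≤M)

  prefactor*normaliser : ∀ N → prefactor N * fromℕ (normaliser N) ≡ 1ℚ
  prefactor*normaliser N = 1/n*n (normaliser N)
    {{ℕₚ.m*n≢0 (2 ℕ.^ N) (N !) {{ℕₚ.m^n≢0 2 N}} {{N ℕₚ.!≢0}}}}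
    where
    lemma : ∀ n → (+ 1 ℤ.* n) ℤ.* + 1 ≡ + 1 ℤ.* (n ℤ.* + 1)
    lemma = ℤSolver.solve-∀
    1/n*n : ∀ n .{{_ : ℕ.NonZero n}} → (+ 1 ℚ./ n) * fromℕ n ≡ 1ℚ
    1/n*n n@(suc m) = ℚₚ.toℚᵘ-injective (begin
      ℚ.toℚᵘ ((+ 1 ℚ./ n) * fromℕ n)             ≈⟨ ℚₚ.toℚᵘ-homo-* (+ 1 ℚ./ n) (fromℕ n) ⟩
      ℚ.toℚᵘ (+ 1 ℚ./ n) ℚᵘ.* ℚ.toℚᵘ (fromℕ n)     ≈⟨ ℚᵘₚ.*-cong (ℚₚ.toℚᵘ-fromℚᵘ (mkℚᵘ (+ 1) m)) (ℚₚ.toℚᵘ-fromℚᵘ (mkℚᵘ (+ n) 0)) ⟩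
      mkℚᵘ (+ 1) m ℚᵘ.* mkℚᵘ (+ n) 0               ≈⟨ *≡* (lemma (+ n)) ⟩
      ℚ.toℚᵘ 1ℚ                                    ∎)
      where open ℚᵘₚ.≃-Reasoning

-- Transfer from ℚ[x] to ℚ(x).

private
  module P = CommutativeRing ℚ[x]-commutativeRing
  module PS = PowerSeries ℚ[x]-commutativeRing
  module K = CommutativeRing ℚ⟨x⟩-commutativeRing
  module KS = PowerSeries ℚ⟨x⟩-commutativeRing
  module KM = Mult K.semiring
  module KΣ = SemiringSum K.semiring
  module PE = SemiringExp P.semiring
  module KE = SemiringExp K.semiring
  ι : ℚ[x] → K.Carrier
  ι = ℚ[x]→ℚ⟨x⟩
  κ : ℚ → K.Carrier
  κ = ℚ→ℚ⟨x⟩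

open ℚ⟨x⟩ using (cross)
open Coefficients using (fromℕ-+; falling-fromℕ; prefactor*normaliser; a-β)

ι-cong : ∀ {p q} → p P.≈ q → ι p K.≈ ι q
ι-cong e = cross (P.*-congʳ e)

ι-+ : ∀ p q → ι (p P.+ q) K.≈ ι p K.+ ι q
ι-+ p q = cross (P.*-cong
  (P.sym (P.+-cong (P.*-identityʳ p) (P.*-identityʳ q))) (P.*-identityˡ P.1#))

ι-* : ∀ p q → ι (p P.* q) K.≈ ι p K.* ι q
ι-* p q = cross (P.*-congˡ {p P.* q} (P.*-identityˡ P.1#))

ι-1ˢ : ∀ n → ι (PS.1ˢ n) K.≈ KS.1ˢ n
ι-1ˢ zero    = K.refl
ι-1ˢ (suc n) = K.refl

ι-*ˢ : ∀ f g n → ι ((f PS.*ˢ g) n) K.≈ ((ι ∘ f) KS.*ˢ (ι ∘ g)) n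
ι-*ˢ f g zero    = K.trans (ι-+ (f 0 P.* g 0) P.0#) (K.+-congʳ {K.0#} {ι (f 0 P.* g 0)} {ι (f 0) K.* ι (g 0)} (ι-* (f 0) (g 0)))
ι-*ˢ f g (suc n) = K.trans (ι-+ (f (suc n) P.* g 0) ((f PS.*ˢ (g ∘ suc)) n))
  (K.+-cong (ι-* (f (suc n)) (g 0)) (ι-*ˢ f (g ∘ suc) n))

ι-^ˢ : ∀ f α n → ι ((f PS.^ˢ α) n) K.≈ ((ι ∘ f) KS.^ˢ α) n
ι-^ˢ f zero    n = ι-1ˢ n
ι-^ˢ f (suc α) n = K.trans (ι-*ˢ f (f PS.^ˢ α) n)
  (SeriesRing.*ˢ-cong ℚ⟨x⟩-commutativeRing {ι ∘ f} {ι ∘ f} (λ _ → K.refl) (ι-^ˢ f α) n)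

κ-fromℕ : ∀ n → κ (fromℕ n) K.≈ n KM.× K.1#
κ-fromℕ zero    = ι-cong {constant 0ℚ} {P.0#} (Polynomial.coeffwise λ { zero → ≡.refl ; (suc _) → ≡.refl })
κ-fromℕ (suc n) = begin
  κ (fromℕ (suc n))           ≡⟨ ≡.cong κ (fromℕ-+ 1 n) ⟩
  κ (1ℚ ℚ.+ fromℕ n)          ≈⟨ ι-+ (constant 1ℚ) (constant (fromℕ n)) ⟩
  K.1# K.+ κ (fromℕ n)        ≈⟨ K.+-congˡ {K.1#} (κ-fromℕ n) ⟩
  suc n KM.× K.1#             ∎
  where open SetoidReasoning K.setoid

κ-fromℕ-* : ∀ n z → κ (fromℕ n) K.* z K.≈ n KM.× z
κ-fromℕ-* n z = begin
  κ (fromℕ n) K.* z           ≈⟨ K.*-congʳ {z} (κ-fromℕ n) ⟩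
  (n KM.× K.1#) K.* z         ≈⟨ KM.×-assoc-* n K.1# z ⟩
  n KM.× (K.1# K.* z)         ≈⟨ KM.×-congʳ n (K.*-identityˡ z) ⟩
  n KM.× z                    ∎
  where open SetoidReasoning K.setoid

κ-* : ∀ p q → κ (p ℚ.* q) K.≈ κ p K.* κ q
κ-* p q = K.trans
  (ι-cong {constant (p ℚ.* q)} {constant p P.* constant q}
    (Polynomial.coeffwise λ { zero → ≡.sym (ℚₚ.+-identityʳ (p ℚ.* q)) ; (suc _) → ≡.refl }))
  (ι-* (constant p) (constant q))

κ-prefactor : ∀ N z → κ (prefactor N) K.* (normaliser N KM.× z) K.≈ z
κ-prefactor N z = begin
  κ c K.* (normaliser N KM.× z)    ≈⟨ K.*-congˡ {κ c} (κ-fromℕ-* (normaliser N) z) ⟨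
  κ c K.* (κ d K.* z)              ≈⟨ K.*-assoc (κ c) (κ d) z ⟨
  κ c K.* κ d K.* z                ≈⟨ K.*-congʳ {z} (κ-* c d) ⟨
  κ (c ℚ.* d) K.* z                ≡⟨ ≡.cong (λ q → κ q K.* z) (prefactor*normaliser N) ⟩
  K.1# K.* z                       ≈⟨ K.*-identityˡ z ⟩
  z                                ∎
  where
  open SetoidReasoning K.setoid
  c = prefactor N
  d = fromℕ (normaliser N)

x⁻¹ : K.Carrier
x⁻¹ = x^ -[1+ 0 ]

x*x⁻¹ : ι X K.* x⁻¹ K.≈ K.1#
x*x⁻¹ = cross (P.trans (P.*-identityʳ (X P.* P.1#))
  (P.sym (P.trans (P.*-identityˡ (P.1# P.* (X P.* P.1#))) (P.*-identityˡ (X P.* P.1#)))))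

-- `x^_` at a negative exponent is the single fraction 1/X^n, whereas the power of `x⁻¹` is a
-- product of fractions; cross-multiplication identifies them one factor at a time.
x^-neg : ∀ n → x^ (ℤ.- + n) K.≈ x⁻¹ KE.^ n
x^-neg zero          = K.refl
x^-neg (suc zero)    = K.sym {x⁻¹ K.* K.1#} {x⁻¹} (K.*-identityʳ x⁻¹)
x^-neg (suc (suc n)) = K.trans {x^ -[1+ suc n ]} {x⁻¹ K.* x^ -[1+ n ]} {x⁻¹ KE.^ suc (suc n)}
  (cross (P.*-cong {P.1#} {P.1# P.* P.1#} {(X P.* P.1#) P.* X PE.^ suc n} {X PE.^ suc (suc n)}
    (P.sym (P.*-identityˡ P.1#)) (P.*-congʳ {X PE.^ suc n} {X P.* P.1#} {X} (P.*-identityʳ X))))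
  (K.*-congˡ {x⁻¹} {x^ -[1+ n ]} {x⁻¹ KE.^ suc n} (x^-neg (suc n)))

ιD₁ : ι (denominator 1) K.≈ K.- (ι X K.+ ι X)
ιD₁ = K.-‿cong (ι-+ X X)

ιD*ιU : ((ι ∘ denominator) KS.*ˢ (ι ∘ U)) KS.≋ KS.1ˢ
ιD*ιU n = K.trans (K.sym (ι-*ˢ denominator U n))
  (K.trans (ι-cong (denominator*generating≋1 n)) (ι-1ˢ n))

-- Matching the summands of the expansion with those of the theorem.

module Expansion = ChebyshevExpansion ℚ⟨x⟩-commutativeRing (ι X) x⁻¹ x*x⁻¹

-- The two are indexed differently: `convolutionTerm N n j l` corresponds to
-- `theoremTerm (suc N) n (suc j) l`, the expansion counting both N and i from zero.
convolutionTerm theoremTerm : (N n i l : ℕ) → K.Carrier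
convolutionTerm = Expansion.convolutionTerm (ι ∘ denominator) (ι ∘ U) ιD₁ K.refl (λ _ → K.refl) ιD*ιU
theoremTerm N n i l =
  κ (fromℕ ((2 ℕ.* N ℕ.+ n ∸ l ∸ i ∸ 1) C (n ∸ l)))
  K.* ι (U (l ℕ.+ i))
  K.* x^ (+ (i ℕ.+ l) ℤ.- + (2 ℕ.* N ℕ.+ n))
  K.* κ (falling (fromℕ (l ℕ.+ i)) i)

module _ {N n j l : ℕ} (j≤N : j ≤ N) (l≤n : l ≤ n) where
  private
    j≤2N : j ≤ 2 ℕ.* N
    j≤2N = ℕₚ.≤-trans j≤N (ℕₚ.m≤m+n N _)
    m k : ℕ
    m = 2 ℕ.* N ∸ j
    k = n ∸ l
    regroup : ∀ j m k l → 2 ℕ.+ (j ℕ.+ m) ℕ.+ (k ℕ.+ l) ≡ (suc m ℕ.+ k) ℕ.+ (suc j ℕ.+ l)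
    regroup = ℕSolver.solve-∀
    -- This splitting settles both the binomial index and the exponent of x: each of them takes away
    -- the summand (j+1) + l, so that the subtraction becomes a cancellation.
    total : 2 ℕ.* suc N ℕ.+ n ≡ (suc m ℕ.+ k) ℕ.+ (suc j ℕ.+ l)
    total = begin
      2 ℕ.* suc N ℕ.+ n                  ≡⟨ ≡.cong (ℕ._+ n) (ℕₚ.*-suc 2 N) ⟩
      2 ℕ.+ 2 ℕ.* N ℕ.+ n                ≡⟨ ≡.cong₂ (λ a b → 2 ℕ.+ a ℕ.+ b) (ℕₚ.m+[n∸m]≡n j≤2N) (ℕₚ.m∸n+n≡m l≤n) ⟨
      2 ℕ.+ (j ℕ.+ m) ℕ.+ (k ℕ.+ l)      ≡⟨ regroup j m k l ⟩
      (suc m ℕ.+ k) ℕ.+ (suc j ℕ.+ l)    ∎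
      where open ≡.≡-Reasoning

  binomial-index : 2 ℕ.* suc N ℕ.+ n ∸ l ∸ suc j ∸ 1 ≡ m ℕ.+ k
  binomial-index = begin
    2 ℕ.* suc N ℕ.+ n ∸ l ∸ suc j ∸ 1          ≡⟨ ≡.cong (_∸ 1) (ℕₚ.∸-+-assoc (2 ℕ.* suc N ℕ.+ n) l (suc j)) ⟩
    2 ℕ.* suc N ℕ.+ n ∸ (l ℕ.+ suc j) ∸ 1      ≡⟨ ≡.cong₂ (λ a b → a ∸ b ∸ 1) total (ℕₚ.+-comm l (suc j)) ⟩
    (suc m ℕ.+ k) ℕ.+ (suc j ℕ.+ l) ∸ (suc j ℕ.+ l) ∸ 1
                                               ≡⟨ ≡.cong (_∸ 1) (ℕₚ.m+n∸n≡m (suc m ℕ.+ k) (suc j ℕ.+ l)) ⟩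
    m ℕ.+ k                                    ∎
    where open ≡.≡-Reasoning

  exponent : + (suc j ℕ.+ l) ℤ.- + (2 ℕ.* suc N ℕ.+ n) ≡ ℤ.- + (suc m ℕ.+ k)
  exponent = ≡.trans (≡.cong (λ s → + (suc j ℕ.+ l) ℤ.- + s) total)
    (cancel (+ (suc m ℕ.+ k)) (+ (suc j ℕ.+ l)))
    where
    cancel : ∀ a b → b ℤ.- (a ℤ.+ b) ≡ ℤ.- a
    cancel = ℤSolver.solve-∀

  summand : convolutionTerm N n j l K.≈ theoremTerm (suc N) n (suc j) l
  summand = begin
    (c KM.× z) K.* (p KM.× u)
      ≈⟨ K.*-cong (κ-fromℕ-* c z) (κ-fromℕ-* p u) ⟨
    (κ (fromℕ c) K.* z) K.* (κ (fromℕ p) K.* u)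
      ≈⟨ solve 4 (λ c z p u → (c :* z) :* (p :* u) := c :* u :* z :* p) K.refl
           (κ (fromℕ c)) z (κ (fromℕ p)) u ⟩
    κ (fromℕ c) K.* u K.* z K.* κ (fromℕ p)
      ≈⟨ K.*-congʳ {κ (fromℕ p)} (K.*-congˡ {κ (fromℕ c) K.* u} (x^-neg (suc m ℕ.+ k))) ⟨
    κ (fromℕ c) K.* u K.* x^ (ℤ.- + (suc m ℕ.+ k)) K.* κ (fromℕ p)
      ≡⟨ ≡.cong₂ (λ e f → κ (fromℕ c) K.* u K.* x^ e K.* κ f) (≡.sym exponent)
           (≡.sym (falling-fromℕ (l ℕ.+ suc j) (suc j) (ℕₚ.m≤n+m (suc j) l))) ⟩
    κ (fromℕ c) K.* u K.* x^ e K.* κ f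
      ≡⟨ ≡.cong (λ i → κ (fromℕ (i C k)) K.* u K.* x^ e K.* κ f) (≡.sym binomial-index) ⟩
    κ (fromℕ ((2 ℕ.* suc N ℕ.+ n ∸ l ∸ suc j ∸ 1) C k)) K.* u K.* x^ e K.* κ f ∎
    where
    open SetoidReasoning K.setoid
    open SemiringSolver K.commutativeSemiring using (solve; _:=_; _:*_)
    c = (m ℕ.+ k) C k
    z = x⁻¹ KE.^ (suc m ℕ.+ k)
    p = (l ℕ.+ suc j) P′ suc j
    u = ι (U (l ℕ.+ suc j))
    e = + (suc j ℕ.+ l) ℤ.- + (2 ℕ.* suc N ℕ.+ n)
    f = falling (fromℕ (l ℕ.+ suc j)) (suc j)

open import Data.Integer.Base using (_-_)
open import Data.Nat.Base using () renaming (_+_ to _+ℕ_; _*_ to _*ℕ_)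
open CommutativeRing ℚ⟨x⟩-commutativeRing using (_≈_; _*_; +-rawMonoid)
open Summation +-rawMonoid using (∑)

theorem2 : (N n : ℕ) → 1 ≤ N →
    ℚ[x]→ℚ⟨x⟩ (U^[ N +ℕ 1 ] n) ≈
    ℚ→ℚ⟨x⟩ (prefactor N) *
    (∑[ i ∈ 1 ⋯ N ]
    (ℚ→ℚ⟨x⟩ (a i N) *
    (∑[ l ∈ 0 ⋯ n ]
    (ℚ→ℚ⟨x⟩ (fromℕ ((2 *ℕ N +ℕ n ∸ l ∸ i ∸ 1) C (n ∸ l)))
    * ℚ[x]→ℚ⟨x⟩ (U (l +ℕ i))
    * x^ (+ (i +ℕ l) - + (2 *ℕ N +ℕ n))
    * ℚ→ℚ⟨x⟩ (falling (fromℕ (l +ℕ i)) i)))))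
theorem2 (suc N) n _ = begin
  ι (U^[ suc N ℕ.+ 1 ] n)
    ≡⟨ ≡.cong (λ α → ι (U^[ α ] n)) (ℕₚ.+-comm (suc N) 1) ⟩
  ι (U^[ suc (suc N) ] n)
    ≈⟨ ι-^ˢ U (suc (suc N)) n ⟩
  ((ι ∘ U) KS.^ˢ suc (suc N)) n
    -- The prefactor is introduced together with its inverse 2^N N!, because the expansion holds for
    -- the normalised power of F.
    ≈⟨ κ-prefactor (suc N) _ ⟨
  κ (prefactor (suc N)) K.* (normaliser (suc N) KM.× ((ι ∘ U) KS.^ˢ suc (suc N)) n)
    ≈⟨ K.*-congˡ {κ (prefactor (suc N))} (Expansion.coefficientExpansion (ι ∘ denominator) (ι ∘ U)
         ιD₁ K.refl (λ _ → K.refl) ιD*ιU N n) ⟩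
  κ (prefactor (suc N)) K.* KΣ.sum {suc N} (λ j → β N (toℕ j) KM.× leftSum (toℕ j))
    ≈⟨ K.*-congˡ {κ (prefactor (suc N))} (KΣ.sum-cong-≋ {suc N} {λ j → β N (toℕ j) KM.× leftSum (toℕ j)}
         {λ j → κ (a (suc (toℕ j)) (suc N)) K.* rightSum (suc (toℕ j))}
         λ j → outer (toℕ≤pred[n] j)) ⟩
  -- Interval sums unfold to sums over an index from zero, with i = 1 + j, so this is the right-hand
  -- side of the theorem by definition.
  κ (prefactor (suc N)) K.* KΣ.sum {suc N} (λ j → κ (a (suc (toℕ j)) (suc N)) K.* rightSum (suc (toℕ j))) ∎
  where
  open SetoidReasoning K.setoid
  leftSum rightSum : ℕ → K.Carrier
  leftSum j = KΣ.sum {suc n} (λ l → convolutionTerm N n j (toℕ l))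
  rightSum i = KΣ.sum {suc n} (λ l → theoremTerm (suc N) n i (toℕ l))
  outer : ∀ {j} → j ≤ N → β N j KM.× leftSum j K.≈ κ (a (suc j) (suc N)) K.* rightSum (suc j)
  outer {j} j≤N = begin
    β N j KM.× leftSum j
      ≈⟨ κ-fromℕ-* (β N j) (leftSum j) ⟨
    κ (fromℕ (β N j)) K.* leftSum j
      ≡⟨ ≡.cong (λ q → κ q K.* leftSum j) (a-β j≤N) ⟨
    κ (a (suc j) (suc N)) K.* leftSum j
      ≈⟨ K.*-congˡ {κ (a (suc j) (suc N))} (KΣ.sum-cong-≋ {suc n}
           {λ l → convolutionTerm N n j (toℕ l)} {λ l → theoremTerm (suc N) n (suc j) (toℕ l)}
           λ l → summand j≤N (toℕ≤pred[n] l)) ⟩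
    κ (a (suc j) (suc N)) K.* rightSum (suc j) ∎
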